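{- Let $\Gamma$ be a distance-regular graph with classical parameters $(D,b,\alpha,\beta)$ such that $b\ge 2$ and $D\ge 3$, which is geometric with respect to a set $\mathcal C$ of Delsarte cliques (the members of $\mathcal C$ are called lines). Let $r=[D]$. If $\beta > (r-\alpha-1)\alpha b + \alpha$, then for every vertex $x$ and line $\ell$ with $d(x,\ell)=1$ and every two vertices $y_1,y_2$ on $\ell$ with $d(x,y_1)=d(x,y_2)=2$, we have $[x,y_1]=[x,y_2]$.
   Context: Distance-regular graph with intersection numbers $b_i,c_i$, valency $k=b_0$. For integer $b\ne1$, $[j]=\frac{b^j-1}{b-1}$. Classical parameters $(D,b,\alpha,\beta)$: diameter $D$, $b_i=([D]-[i])(\beta-\alpha[i])$ ($0\le i\le D-1$), $c_i=[i](1+\alpha[i-1])$ ($1\le i\le D$). A Delsarte clique is a clique with $1+\frac{k}{ -\theta_{\min}}$ vertices, $\theta_{\min}$ the smallest adjacency eigenvalue. $\Gamma$ is geometric with respect to a set $\mathcal C$ of Delsarte cliques if every edge lies in exactly one member of $\mathcal C$. $d(x,\ell)=\min\{d(x,y): y\in\ell\}$. For vertices $x,y$ at distance 2, $[x,y]$ is the set of lines $\ell\in\mathcal C$ through $x$ such that $d(y,u)\le 2$ for all $u\in\ell$. -}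

module Defs where

open import Level using (Level; 0ℓ; _⊔_) renaming (suc to lsuc)
open import Data.Bool.Base using (if_then_else_)
open import Data.Nat.Base using (ℕ; zero; suc; _≤_; _<_; z≤n; s≤s)
import Data.Nat.Properties as ℕ
open import Data.Integer.Base as ℤ using (ℤ; +_; -[1+_]; 1ℤ)
open import Data.Fin.Base using (Fin)
import Data.Fin.Properties as Fin
open import Data.Fin.Subset using (Subset; _∈_; ∣_∣)
open import Data.Vec.Base using (count; allFin)
open import Data.Vec.Functional using (Vector)
open import Data.Product.Base using (Σ; ∃; _×_; _,_; proj₁; proj₂)
open import Data.Product using (∃!)
open import Data.Sum.Base using (_⊎_)
open import Function.Bundles using (_⇔_)
open import Relation.Nullary.Decidable using (yes; no; does; _×-dec_)
open import Relation.Nullary.Negation using (¬_; contradiction)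
open import Relation.Binary.Core using (Rel)
open import Relation.Binary.Definitions using (Irreflexive; Symmetric)
import Relation.Binary.Definitions as Binary
open import Relation.Binary.Structures using (IsStrictPartialOrder)
open import Relation.Binary.PropositionalEquality using (_≡_; _≢_)
open import Relation.Unary using (Pred; Decidable)
open import Algebra.Bundles using (CommutativeRing)
open import Algebra.Apartness.Bundles using (HeytingField; HeytingCommutativeRing)
open import Algebra.Definitions using (Invertible)
import Algebra.Definitions.RawMonoid as RawMonoidDefs

-- The real numbers, characterised as a Cauchy complete Archimedean ordered
-- field.  The axioms are the constructive ones, so that they hold of Cauchy
-- sequences of rationals; classically they determine ℝ up to isomorphism.

record RealNumbers (c ℓ₁ ℓ₂ : Level) : Set (lsuc (c ⊔ ℓ₁ ⊔ ℓ₂)) where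
  field
    heytingField : HeytingField c ℓ₁ ℓ₂

  open HeytingField heytingField public

  ring : CommutativeRing c ℓ₁
  ring = HeytingCommutativeRing.commutativeRing heytingCommutativeRing

  open RawMonoidDefs (CommutativeRing.+-rawMonoid ring) public
    using (sum) renaming (_×_ to _·_)

  infix 4 _<ᴿ_ _≤ᴿ_

  field
    _<ᴿ_                 : Rel Carrier ℓ₂
    isStrictPartialOrder : IsStrictPartialOrder _≈_ _<ᴿ_
    #⇔<⊎>                : ∀ x y → x # y ⇔ (x <ᴿ y ⊎ y <ᴿ x)
    +-monoʳ-<            : ∀ z {x y} → x <ᴿ y → z + x <ᴿ z + y
    *-pos                : ∀ {x y} → 0# <ᴿ x → 0# <ᴿ y → 0# <ᴿ x * y
    archimedean          : ∀ x → ∃ λ n → x <ᴿ n · 1#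

  _≤ᴿ_ : Rel Carrier ℓ₂
  x ≤ᴿ y = ¬ (y <ᴿ x)

  Cauchy : (ℕ → Carrier) → Set (c ⊔ ℓ₂)
  Cauchy s = ∀ ε → 0# <ᴿ ε →
    ∃ λ N → ∀ m n → N ≤ m → N ≤ n → s m - s n <ᴿ ε

  _ConvergesTo_ : (ℕ → Carrier) → Carrier → Set (c ⊔ ℓ₂)
  s ConvergesTo x = ∀ ε → 0# <ᴿ ε →
    ∃ λ N → ∀ n → N ≤ n → (s n - x <ᴿ ε) × (x - s n <ᴿ ε)

  field
    complete : ∀ s → Cauchy s → ∃ λ x → s ConvergesTo x

  fromℕ : ℕ → Carrier
  fromℕ n = n · 1#

  fromℤ : ℤ → Carrier
  fromℤ (+ n)      = fromℕ n
  fromℤ (-[1+ n ]) = - fromℕ (suc n)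

-- The floor division is exact, since b - 1 divides b ^ j - 1.

qint : (b : ℤ) .{{_ : ℤ.NonZero (b ℤ.- 1ℤ)}} → ℕ → ℤ
qint b j = (b ℤ.^ j ℤ.- 1ℤ) ℤ./ (b ℤ.- 1ℤ)

least : ∀ {p} {P : Pred ℕ p} → Decidable P → ∀ m → P m →
        ∃ λ k → P k × (∀ j → P j → k ≤ j)
least P? zero p = zero , p , λ _ _ → z≤n
least {P = P} P? (suc m) p with P? zero
... | yes p₀ = zero , p₀ , λ _ _ → z≤n
... | no ¬p₀ with least {P = λ k → P (suc k)} (λ k → P? (suc k)) m p
...   | k , pk , min = suc k , pk , λ where
          zero    q → contradiction q ¬p₀
          (suc j) q → s≤s (min j q)

module Walks {n : ℕ} (Adj : Rel (Fin n) 0ℓ) where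

  Walk : ℕ → Rel (Fin n) 0ℓ
  Walk zero    x y = x ≡ y
  Walk (suc k) x y = ∃ λ z → Adj x z × Walk k z y

  walk? : Binary.Decidable Adj → ∀ k → Binary.Decidable (Walk k)
  walk? adj? zero    x y = x Fin.≟ y
  walk? adj? (suc k) x y = Fin.any? λ z → adj? x z ×-dec walk? adj? k z y

record ConnectedGraph : Set₁ where
  field
    order     : ℕ
  Vertex : Set
  Vertex = Fin order
  field
    Adj       : Rel Vertex 0ℓ
    adj?      : Binary.Decidable Adj
    sym       : Symmetric Adj
    irrefl    : Irreflexive _≡_ Adj
  open Walks Adj public
  field
    connected : ∀ x y → ∃ λ k → Walk k x y

  d : Vertex → Vertex → ℕ
  d x y = proj₁ (least (λ k → walk? adj? k x y) m w)
    where
    m = proj₁ (connected x y)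
    w = proj₂ (connected x y)

  HasDiameter : ℕ → Set
  HasDiameter D = (∀ x y → d x y ≤ D) × (∃ λ x → ∃ λ y → d x y ≡ D)

  -- The values of b at the diameter and beyond, and of c at 0 and beyond the
  -- diameter, carry no information.

  record IsDistanceRegular (b c : ℕ → ℕ) : Set where
    field
      b-count : ∀ x y →
        count (λ z → adj? y z ×-dec (d x z ℕ.≟ suc (d x y))) (allFin order)
          ≡ b (d x y)
      c-count : ∀ x y →
        count (λ z → adj? y z ×-dec (suc (d x z) ℕ.≟ d x y)) (allFin order)
          ≡ c (d x y)

  IsClique : Subset order → Set
  IsClique S = ∀ x y → x ∈ S → y ∈ S → x ≢ y → Adj x y

  DistanceToSet : Vertex → Subset order → ℕ → Set
  DistanceToSet x S m =
    (∃ λ y → y ∈ S × d x y ≡ m) × (∀ y → y ∈ S → m ≤ d x y)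

  Bracket : ∀ {p} → Pred (Subset order) p → Vertex → Vertex →
            Pred (Subset order) p
  Bracket 𝒞 x y ℓ = 𝒞 ℓ × x ∈ ℓ × (∀ u → u ∈ ℓ → d y u ≤ 2)

module _ {c ℓ₁ ℓ₂} (ℝ : RealNumbers c ℓ₁ ℓ₂) (Γ : ConnectedGraph) where
  open RealNumbers ℝ
  open ConnectedGraph Γ using (order; Vertex; Adj; adj?; IsClique; HasDiameter)

  adjacencyMatrix : Vertex → Vertex → Carrier
  adjacencyMatrix x y = if does (adj? x y) then 1# else 0#

  IsEigenvalue : Carrier → Set (c ⊔ ℓ₁ ⊔ ℓ₂)
  IsEigenvalue θ = Σ (Vector Carrier order) λ v →
    (∃ λ x → v x # 0#) ×
    (∀ x → sum (λ y → adjacencyMatrix x y * v y) ≈ θ * v x)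

  IsSmallestEigenvalue : Carrier → Set (c ⊔ ℓ₁ ⊔ ℓ₂)
  IsSmallestEigenvalue θ = IsEigenvalue θ × (∀ η → IsEigenvalue η → θ ≤ᴿ η)

  -- Here k is the valency, and the component proj₁ inv is the reciprocal of - θ.

  IsDelsarteClique : (k : ℕ) → Subset order → Set (c ⊔ ℓ₁ ⊔ ℓ₂)
  IsDelsarteClique k S = IsClique S × ∃ λ θ → IsSmallestEigenvalue θ ×
    Σ (Invertible _≈_ 1# _*_ (- θ)) λ inv →
      fromℕ ∣ S ∣ ≈ 1# + fromℕ k * proj₁ inv

  IsGeometric : ∀ {p} → (k : ℕ) → Pred (Subset order) p →
                Set (c ⊔ ℓ₁ ⊔ ℓ₂ ⊔ p)
  IsGeometric k 𝒞 =
    (∀ S → 𝒞 S → IsDelsarteClique k S) ×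
    (∀ x y → Adj x y → ∃! _≡_ λ S → 𝒞 S × x ∈ S × y ∈ S)

  record HasClassicalParameters
    (bᵢ cᵢ : ℕ → ℕ) (D : ℕ) (b : ℤ) .{{_ : ℤ.NonZero (b ℤ.- 1ℤ)}}
    (α β : Carrier) : Set ℓ₁ where
    [_] : ℕ → Carrier
    [ j ] = fromℤ (qint b j)
    field
      diameter  : HasDiameter D
      b-formula : ∀ i → i < D →
        fromℕ (bᵢ i) ≈ ([ D ] - [ i ]) * (β - α * [ i ])
      c-formula : ∀ i → i < D →
        fromℕ (cᵢ (suc i)) ≈ [ suc i ] * (1# + α * [ i ])

{-# OPTIONS --safe #-}
module Submission where

-- The vector w with w_{i+1} = - (1 + α [i]) / (β - α [i]) w_i, read along the
-- distance from a fixed vertex, is an eigenvector for - r.  As its entries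
-- alternate in sign, a Christoffel-Darboux argument shows that no eigenvalue is
-- smaller.  So lines have 1 + β points, each point is on r lines, and the
-- incidence matrix N satisfies N Nᵀ = A + r.  Hence w sums to 0 over every line,
-- so a line whose points are at distances j and j + 1 from a vertex has exactly
-- 1 + α [j] points at distance j.
--
-- For x and ℓ as in the theorem let G be the set of the β - α points of ℓ at
-- distance 2 from x.  By counting, [x , y] consists of the b + 1 lines through
-- x with a neighbour of y ∈ G.  At least 1 + α lines through x are in [x , y]
-- for all y ∈ G; call them full.  A line through x that is not full is in
-- [x , y] for at most α b points y ∈ G.  If [x , y₁] contains a line that is
-- not full, there are at most b full lines, and counting the pairs of y ∈ G and
-- a line of [x , y] gives β - α ≤ (r - 1 - α) α b.

open import Defs
open import Level using (Level; 0ℓ)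
open import Data.Bool.Base using (if_then_else_; true; false)
import Data.Bool.Properties as Bool
open import Data.Empty using (⊥)
open import Data.Nat.Base as ℕ using (ℕ; zero; suc; pred; z≤n; s≤s; _≤_; _<_)
import Data.Nat.DivMod as ℕ
import Data.Nat.Properties as ℕ
open import Data.Nat.Solver using (module +-*-Solver)
open import Data.Integer.Base as ℤ using (ℤ; +_; -[1+_]; 1ℤ)
import Data.Integer.DivMod as ℤ
import Data.Integer.Properties as ℤ
import Data.Sign.Base as Sign
open import Data.Fin.Base as Fin using (Fin; zero; suc)
import Data.Fin.Properties as Fin
open import Data.Fin.Subset using (Subset; _∈_; _∉_; ∣_∣)
open import Data.Fin.Subset.Properties using (_∈?_)
open import Data.List.Base as List using (List; []; _∷_; concatMap)
open import Data.List.Membership.Propositional using (lose; find) renaming (_∈_ to _∈ᴸ_)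
open import Data.List.Membership.Propositional.Properties
  using (∈-concatMap⁺; ∈-concatMap⁻; ∈-deduplicate⁺; ∈-deduplicate⁻; ∈-allFin; ∈-lookup)
import Data.List.Relation.Unary.All as All
open import Data.List.Relation.Unary.AllPairs using (_∷_)
open import Data.List.Relation.Unary.Any as Any using (here)
open import Data.List.Relation.Unary.Any.Properties using (lookup-index)
open import Data.List.Relation.Unary.Unique.DecPropositional.Properties using (deduplicate-!)
open import Data.List.Relation.Unary.Unique.Propositional using (Unique)
open import Data.Maybe.Base as Maybe using ()
open import Data.Product.Base using (∃; _×_; _,_; proj₁; proj₂)
open import Data.Sum.Base as Sum using (_⊎_; inj₁; inj₂)
open import Data.Vec.Base as Vec using ([]; _∷_; count)
open import Data.Vec.Properties using (≡-dec)
open import Function.Base using (_∘_; id)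
open import Function.Bundles using (Equivalence)
open import Relation.Nullary using (¬_; Dec; contradiction; yes; no; does)
open import Relation.Nullary.Decidable.Core using (dec⇒maybe; _×-dec_; ¬?)
open import Relation.Unary using (Pred; Decidable; _≐_)
open import Relation.Binary.Definitions using (tri<; tri≈; tri>)
open import Relation.Binary.PropositionalEquality as ≡ using (_≡_; _≢_; module ≡-Reasoning)
open import Relation.Binary.Structures using (IsStrictPartialOrder)
open import Algebra.Bundles using (CommutativeRing; Semiring)
open import Algebra.Solver.Ring.AlmostCommutativeRing using (fromCommutativeRing; _-Raw-AlmostCommutative⟶_)
import Algebra.Apartness.Properties.HeytingCommutativeRing as HeytingProperties
import Algebra.Properties.Ring as RingProperties
import Algebra.Properties.Semiring.Mult as Mult
import Algebra.Properties.Semiring.Mult.TCOptimised as Multᵒ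
import Algebra.Properties.Semiring.Sum as SemiringSum
import Algebra.Solver.Ring as RingSolver
import Relation.Binary.Reasoning.Setoid as SetoidReasoning

-- The size 1 + k / (- θ_min) of a Delsarte clique is of no use until θ_min is known, and positive
-- semidefiniteness of N Nᵀ cannot supply it: counting with that size only shows that a point is on
-- - θ_min lines. Hence the separate argument from the intersection numbers. If θ < - r, the
-- alternating signs of w make the weighted sums of an eigenvector over growing balls positive and
-- increasing, while the sum over the whole graph has to vanish.
--
-- The constant α b is the difference of 1 + α [2], the number of points at distance 2 on a line
-- whose distances are 2 and 3, and 1 + α, the number of points of ℓ next to x. The threshold on β
-- arises as follows. A line of [x , y₁] that is not full occupies one of b + 1 places, which leaves
-- at most b for the full lines. In the count of pairs, the full lines are then absorbed by b of the
-- b + 1 lines per point of G. The remaining line per point has to come from the lines that are not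
-- full, of which there are at most r - 1 - α, each serving at most α b points.

-- Finite sums and indicators over a semiring.

module Summation {c ℓ} (S : Semiring c ℓ) where
  open Semiring S hiding (zero)
  open SemiringSum S

  private variable
    n m : ℕ
    p q : Level
    P : Set p
    Q : Set q

  -- Opaque, so that unification can read f off from ∑ f.
  opaque
    ∑ : (Fin n → Carrier) → Carrier
    ∑ = sum

    ∑≡sum : (f : Fin n → Carrier) → ∑ f ≡ sum f
    ∑≡sum f = ≡.refl

    ∑-cong : {f g : Fin n → Carrier} → (∀ i → f i ≈ g i) → ∑ f ≈ ∑ g
    ∑-cong = sum-cong-≋

    ∑-zero : {f : Fin n → Carrier} → (∀ i → f i ≈ 0#) → ∑ f ≈ 0#
    ∑-zero {n} eq = trans (∑-cong eq) (sum-replicate-zero n)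

    ∑-+ : (f g : Fin n → Carrier) → ∑ (λ i → f i + g i) ≈ ∑ f + ∑ g
    ∑-+ = ∑-distrib-+

    ∑-*ˡ : ∀ x (f : Fin n → Carrier) → ∑ (λ i → x * f i) ≈ x * ∑ f
    ∑-*ˡ x f = sym (*-distribˡ-sum x f)

    ∑-*ʳ : ∀ x (f : Fin n → Carrier) → ∑ (λ i → f i * x) ≈ ∑ f * x
    ∑-*ʳ x f = sym (*-distribʳ-sum x f)

    ∑-swap : (f : Fin m → Fin n → Carrier) →
             ∑ (λ i → ∑ (λ j → f i j)) ≈ ∑ (λ j → ∑ (λ i → f i j))
    ∑-swap = ∑-comm

    ∑-only : {f : Fin n → Carrier} → ∀ i → (∀ j → i ≢ j → f j ≈ 0#) → ∑ f ≈ f i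
    ∑-only zero    eq = trans (+-congˡ (∑-zero λ j → eq (suc j) λ ())) (+-identityʳ _)
    ∑-only (suc i) eq = trans
      (+-cong (eq zero λ ()) (∑-only i λ j i≢j → eq (suc j) (i≢j ∘ Fin.suc-injective)))
      (+-identityˡ _)

  -- Branching on `does` makes an entry of `adjacencyMatrix` definitionally an indicator, so facts
  -- about indicators apply to the matrix directly.
  𝟙 : Dec P → Carrier
  𝟙 p? = if does p? then 1# else 0#

  𝟙-true : (p? : Dec P) → P → 𝟙 p? ≡ 1#
  𝟙-true (yes _) _ = ≡.refl
  𝟙-true (no ¬p) p = contradiction p ¬p

  𝟙-false : (p? : Dec P) → ¬ P → 𝟙 p? ≡ 0#
  𝟙-false (yes p) ¬p = contradiction p ¬p
  𝟙-false (no _)  _  = ≡.refl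

  𝟙-⇔ : (p? : Dec P) (q? : Dec Q) → (P → Q) → (Q → P) → 𝟙 p? ≡ 𝟙 q?
  𝟙-⇔ (yes p) q? to from = ≡.sym (𝟙-true q? (to p))
  𝟙-⇔ (no ¬p) q? to from = ≡.sym (𝟙-false q? (¬p ∘ from))

  𝟙-× : (p? : Dec P) (q? : Dec Q) → 𝟙 (p? ×-dec q?) ≈ 𝟙 p? * 𝟙 q?
  𝟙-× (yes _) q? = sym (*-identityˡ _)
  𝟙-× (no _)  q? = sym (zeroˡ _)

  𝟙-*-cong : (p? : Dec P) {x y : Carrier} → (P → x ≈ y) → 𝟙 p? * x ≈ 𝟙 p? * y
  𝟙-*-cong (yes p) eq = *-congˡ (eq p)
  𝟙-*-cong (no _)  eq = trans (zeroˡ _) (sym (zeroˡ _))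

-- Cardinalities as sums of natural numbers.

module Counting where
  open Summation ℕ.+-*-semiring public

  private variable
    n : ℕ
    p : Level

  opaque
    unfolding ∑

    count≡∑ : {A : Set} {P : Pred A p} (P? : Decidable P) (f : Fin n → A) →
              count P? (Vec.tabulate f) ≡ ∑ (λ i → 𝟙 (P? (f i)))
    count≡∑ {n = zero}  P? f = ≡.refl
    count≡∑ {n = suc n} P? f with does (P? (f zero))
    ... | true  = ≡.cong suc (count≡∑ P? (f ∘ suc))
    ... | false = count≡∑ P? (f ∘ suc)

    ∣∣≡∑ : (S : Subset n) → ∣ S ∣ ≡ ∑ (λ i → 𝟙 (i ∈? S))
    ∣∣≡∑ []          = ≡.refl
    ∣∣≡∑ (true  ∷ S) = ≡.cong suc (∣∣≡∑ S)
    ∣∣≡∑ (false ∷ S) = ∣∣≡∑ S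

    ∑-mono : {f g : Fin n → ℕ} → (∀ i → f i ≤ g i) → ∑ f ≤ ∑ g
    ∑-mono {zero}  f≤g = z≤n
    ∑-mono {suc n} f≤g = ℕ.+-mono-≤ (f≤g zero) (∑-mono (f≤g ∘ suc))

    term≤∑ : (f : Fin n → ℕ) (i : Fin n) → f i ≤ ∑ f
    term≤∑ f zero    = ℕ.m≤m+n _ _
    term≤∑ f (suc i) = ℕ.≤-trans (term≤∑ (f ∘ suc) i) (ℕ.m≤n+m _ _)

  ∑-𝟙-pos : {P : Pred (Fin n) p} (P? : Decidable P) (i : Fin n) → P i → 1 ≤ ∑ (λ i → 𝟙 (P? i))
  ∑-𝟙-pos P? i pi = ≡.subst (_≤ ∑ (λ i → 𝟙 (P? i))) (𝟙-true (P? i) pi) (term≤∑ (λ i → 𝟙 (P? i)) i)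

  𝟙-≤ : ∀ {p q} {P : Set p} {Q : Set q} (p? : Dec P) (q? : Dec Q) → (P → Q) → 𝟙 p? ≤ 𝟙 q?
  𝟙-≤ (yes p) q? P⇒Q = ℕ.≤-reflexive (≡.sym (𝟙-true q? (P⇒Q p)))
  𝟙-≤ (no _)  q? _   = z≤n

  𝟙-disjoint-≤ : ∀ {p q r} {P : Set p} {Q : Set q} {R : Set r} (p? : Dec P) (q? : Dec Q) (r? : Dec R) →
                 (P → Q → ⊥) → (P → R) → (Q → R) → 𝟙 p? ℕ.+ 𝟙 q? ≤ 𝟙 r?
  𝟙-disjoint-≤ (yes p) q? r? disjoint P⇒R _ =
    ℕ.≤-reflexive (≡.trans (≡.cong suc (𝟙-false q? (disjoint p))) (≡.sym (𝟙-true r? (P⇒R p))))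
  𝟙-disjoint-≤ (no _)  q? r? _ _ Q⇒R = 𝟙-≤ q? r? Q⇒R

  𝟙-partition : ∀ {p q r} {P : Set p} {Q : Set q} {R : Set r} (p? : Dec P) (q? : Dec Q) (r? : Dec R) →
                (P → Q → ⊥) → (P → R) → (Q → R) → (R → P ⊎ Q) → 𝟙 r? ≡ 𝟙 p? ℕ.+ 𝟙 q?
  𝟙-partition p? q? (no ¬r) _ P⇒R Q⇒R _ = ≡.sym (≡.cong₂ ℕ._+_ (𝟙-false p? (¬r ∘ P⇒R)) (𝟙-false q? (¬r ∘ Q⇒R)))
  𝟙-partition p? q? (yes r) disjoint _ _ R⇒ with R⇒ r
  ... | inj₁ p = ≡.sym (≡.cong₂ ℕ._+_ (𝟙-true p? p) (𝟙-false q? (disjoint p)))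
  ... | inj₂ q = ≡.sym (≡.cong₂ ℕ._+_ (𝟙-false p? λ p → disjoint p q) (𝟙-true q? q))

  ∑-𝟙-unique-≤ : ∀ {q} {P : Pred (Fin n) p} {Q : Set q} (P? : Decidable P) (q? : Dec Q) →
                 (∀ {i} → P i → Q) → (∀ {i j} → P i → P j → i ≡ j) → ∑ (λ i → 𝟙 (P? i)) ≤ 𝟙 q?
  ∑-𝟙-unique-≤ P? q? P⇒Q unique with Fin.any? P?
  ... | no ¬∃        = ℕ.≤-trans (ℕ.≤-reflexive (∑-zero λ i → 𝟙-false (P? i) λ pi → ¬∃ (i , pi))) z≤n
  ... | yes (i , pi) = ℕ.≤-trans
    (ℕ.≤-reflexive (∑-only i λ j i≢j → 𝟙-false (P? j) λ pj → i≢j (unique pi pj)))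
    (𝟙-≤ (P? i) q? P⇒Q)

-- Constructive order and field arithmetic of the reals.

module RealProperties {c ℓ₁ ℓ₂} (ℝ : RealNumbers c ℓ₁ ℓ₂) where

  open RealNumbers ℝ hiding (sum; zero) public
  open CommutativeRing ring public using (semiring) renaming (ring to nonCommutativeRing)
  open RingProperties nonCommutativeRing using (-0#≈0#; -‿involutive; -‿distribˡ-*; -‿distribʳ-*; -‿+-comm)
  open HeytingProperties heytingCommutativeRing public using (1#0; x-0≈x)
  open Mult semiring using (×-homo-+; ×1-homo-*)
  private module ᵒ = Multᵒ semiring
  open SetoidReasoning setoid

  private
    -- Unlike `fromℤ`, this sends 1 to `1#` itself and not to `1# + 0#`, so `con (+ 1)` in a solver
    -- equation denotes a literal `1#`.
    ⟦_⟧ᵒ : ℤ → Carrier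
    ⟦ + n ⟧ᵒ      = n ᵒ.× 1#
    ⟦ -[1+ n ] ⟧ᵒ = - (suc n ᵒ.× 1#)

    ⊖-homo : ∀ m n → ⟦ m ℤ.⊖ n ⟧ᵒ ≈ m ᵒ.× 1# - n ᵒ.× 1#
    ⊖-homo zero    zero    = sym (-‿inverseʳ 0#)
    ⊖-homo zero    (suc n) = sym (+-identityˡ _)
    ⊖-homo (suc m) zero    = sym (x-0≈x _)
    ⊖-homo (suc m) (suc n) = begin
      ⟦ suc m ℤ.⊖ suc n ⟧ᵒ                  ≡⟨ ≡.cong ⟦_⟧ᵒ (ℤ.[1+m]⊖[1+n]≡m⊖n m n) ⟩
      ⟦ m ℤ.⊖ n ⟧ᵒ                          ≈⟨ ⊖-homo m n ⟩
      m ᵒ.× 1# - n ᵒ.× 1#                   ≈⟨ +-congˡ (+-identityʳ _) ⟨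
      m ᵒ.× 1# + (- (n ᵒ.× 1#) + 0#)        ≈⟨ +-congˡ (+-congˡ (-‿inverseʳ 1#)) ⟨
      m ᵒ.× 1# + (- (n ᵒ.× 1#) + (1# - 1#)) ≈⟨ +-congˡ (+-assoc _ _ _) ⟨
      m ᵒ.× 1# + (- (n ᵒ.× 1#) + 1# - 1#)   ≈⟨ +-congˡ (+-congʳ (+-comm _ _)) ⟩
      m ᵒ.× 1# + (1# - n ᵒ.× 1# - 1#)       ≈⟨ +-congˡ (+-assoc _ _ _) ⟩
      m ᵒ.× 1# + (1# + (- (n ᵒ.× 1#) - 1#)) ≈⟨ +-assoc _ _ _ ⟨
      m ᵒ.× 1# + 1# + (- (n ᵒ.× 1#) - 1#)   ≈⟨ +-cong (+-comm _ _) (trans (-‿+-comm _ _) (-‿cong (+-comm _ _))) ⟩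
      1# + m ᵒ.× 1# - (1# + n ᵒ.× 1#)       ≈⟨ +-cong (ᵒ.1+× m 1#) (-‿cong (ᵒ.1+× n 1#)) ⟨
      suc m ᵒ.× 1# - suc n ᵒ.× 1#           ∎

    +-homo : ∀ i j → ⟦ i ℤ.+ j ⟧ᵒ ≈ ⟦ i ⟧ᵒ + ⟦ j ⟧ᵒ
    +-homo (+ m)    (+ n)    = ᵒ.×-homo-+ 1# m n
    +-homo (+ m)    -[1+ n ] = ⊖-homo m (suc n)
    +-homo -[1+ m ] (+ n)    = trans (⊖-homo n (suc m)) (+-comm _ _)
    +-homo -[1+ m ] -[1+ n ] = begin
      - (suc (suc (m ℕ.+ n)) ᵒ.× 1#)      ≡⟨ ≡.cong (λ k → - (suc k ᵒ.× 1#)) (ℕ.+-suc m n) ⟨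
      - ((suc m ℕ.+ suc n) ᵒ.× 1#)        ≈⟨ -‿cong (ᵒ.×-homo-+ 1# (suc m) (suc n)) ⟩
      - (suc m ᵒ.× 1# + suc n ᵒ.× 1#)     ≈⟨ -‿+-comm _ _ ⟨
      - (suc m ᵒ.× 1#) - suc n ᵒ.× 1#     ∎

    +◃-homo : ∀ n → ⟦ Sign.+ ℤ.◃ n ⟧ᵒ ≈ n ᵒ.× 1#
    +◃-homo zero    = refl
    +◃-homo (suc n) = refl

    -◃-homo : ∀ n → ⟦ Sign.- ℤ.◃ n ⟧ᵒ ≈ - (n ᵒ.× 1#)
    -◃-homo zero    = sym -0#≈0#
    -◃-homo (suc n) = refl

    *-homo : ∀ i j → ⟦ i ℤ.* j ⟧ᵒ ≈ ⟦ i ⟧ᵒ * ⟦ j ⟧ᵒ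
    *-homo (+ m)    (+ n)    = trans (+◃-homo (m ℕ.* n)) (ᵒ.×1-homo-* m n)
    *-homo (+ m)    -[1+ n ] = trans (-◃-homo (m ℕ.* suc n))
      (trans (-‿cong (ᵒ.×1-homo-* m (suc n))) (-‿distribʳ-* _ _))
    *-homo -[1+ m ] (+ n)    = trans (-◃-homo (suc m ℕ.* n))
      (trans (-‿cong (ᵒ.×1-homo-* (suc m) n)) (-‿distribˡ-* _ _))
    *-homo -[1+ m ] -[1+ n ] = begin
      (suc m ℕ.* suc n) ᵒ.× 1#                ≈⟨ ᵒ.×1-homo-* (suc m) (suc n) ⟩
      suc m ᵒ.× 1# * suc n ᵒ.× 1#             ≈⟨ -‿involutive _ ⟨
      - - (suc m ᵒ.× 1# * suc n ᵒ.× 1#)       ≈⟨ -‿cong (-‿distribʳ-* _ _) ⟩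
      - (suc m ᵒ.× 1# * - (suc n ᵒ.× 1#))     ≈⟨ -‿distribˡ-* _ _ ⟩
      - (suc m ᵒ.× 1#) * - (suc n ᵒ.× 1#)     ∎

    -‿homo : ∀ i → ⟦ ℤ.- i ⟧ᵒ ≈ - ⟦ i ⟧ᵒ
    -‿homo (+ zero)  = sym -0#≈0#
    -‿homo (+ suc n) = refl
    -‿homo -[1+ n ]  = sym (-‿involutive _)

    morphism : ℤ.+-*-rawRing -Raw-AlmostCommutative⟶ fromCommutativeRing ring
    morphism = record
      { ⟦_⟧    = ⟦_⟧ᵒ
      ; +-homo = +-homo
      ; *-homo = *-homo
      ; -‿homo = -‿homo
      ; 0-homo = refl
      ; 1-homo = refl
      }

  -- Equality of reals is undecidable, so the coefficients are integers: their decidable equality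
  -- lets the normaliser recognise terms that cancel.
  module Solver = RingSolver ℤ.+-*-rawRing (fromCommutativeRing ring) morphism
    (λ i j → Maybe.map (reflexive ∘ ≡.cong ⟦_⟧ᵒ) (dec⇒maybe (i ℤ.≟ j)))

  open Solver using (solve; _:=_; _:+_; _:*_; _:-_; :-_; con)

  fromℕ-+ : ∀ m n → fromℕ (m ℕ.+ n) ≈ fromℕ m + fromℕ n
  fromℕ-+ = ×-homo-+ 1#

  fromℕ-* : ∀ m n → fromℕ (m ℕ.* n) ≈ fromℕ m * fromℕ n
  fromℕ-* = ×1-homo-*

  open IsStrictPartialOrder isStrictPartialOrder public
    using () renaming (irrefl to <-irrefl; trans to <-trans; asym to <-asym; <-respʳ-≈ to <-respʳ; <-respˡ-≈ to <-respˡ)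

  0<y-x : ∀ {x y} → x <ᴿ y → 0# <ᴿ y - x
  0<y-x {x} {y} x<y = <-respˡ (-‿inverseˡ x) (<-respʳ (+-comm _ _) (+-monoʳ-< (- x) x<y))

  0<y-x⇒x<y : ∀ {x y} → 0# <ᴿ y - x → x <ᴿ y
  0<y-x⇒x<y {x} {y} 0<y-x = <-respˡ (+-identityʳ x)
    (<-respʳ (solve 2 (λ x y → x :+ (y :- x) := y) refl x y) (+-monoʳ-< x 0<y-x))

  x<0⇒0<-x : ∀ {x} → x <ᴿ 0# → 0# <ᴿ - x
  x<0⇒0<-x x<0 = <-respʳ (+-identityˡ _) (0<y-x x<0)

  +-pos : ∀ {x y} → 0# <ᴿ x → 0# <ᴿ y → 0# <ᴿ x + y
  +-pos {x} 0<x 0<y = <-trans 0<x (<-respˡ (+-identityʳ x) (+-monoʳ-< x 0<y))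

  #⇒< : ∀ {x y} → x # y → x <ᴿ y ⊎ y <ᴿ x
  #⇒< {x} {y} = Equivalence.to (#⇔<⊎> x y)

  <⇒# : ∀ {x y} → x <ᴿ y → x # y
  <⇒# {x} {y} = Equivalence.from (#⇔<⊎> x y) ∘ inj₁

  >⇒# : ∀ {x y} → y <ᴿ x → x # y
  >⇒# {x} {y} = Equivalence.from (#⇔<⊎> x y) ∘ inj₂

  ≤-antisym : ∀ {x y} → ¬ (x <ᴿ y) → ¬ (y <ᴿ x) → x ≈ y
  ≤-antisym {x} {y} x≮y y≮x = proj₁ (tight x y) λ x#y → case (#⇒< x#y)
    where
    case : ¬ (x <ᴿ y ⊎ y <ᴿ x)
    case (inj₁ x<y) = x≮y x<y
    case (inj₂ y<x) = y≮x y<x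

  -x*-x≈x*x : ∀ x → - x * - x ≈ x * x
  -x*-x≈x*x = solve 1 (λ x → :- x :* :- x := x :* x) refl

  square-pos : ∀ {x} → x # 0# → 0# <ᴿ x * x
  square-pos {x} x#0 with #⇒< x#0
  ... | inj₁ x<0 = <-respʳ (-x*-x≈x*x x) (*-pos (x<0⇒0<-x x<0) (x<0⇒0<-x x<0))
  ... | inj₂ 0<x = *-pos 0<x 0<x

  0<1 : 0# <ᴿ 1#
  0<1 = <-respʳ (*-identityˡ 1#) (square-pos 1#0)

  inverse : ∀ {x} → x # 0# → ∃ λ y → y * x ≈ 1#
  inverse {x} x#0 with #⇒invertible x#0
  ... | y , yx≈1 , _ = y , trans (*-congˡ (sym (x-0≈x x))) yx≈1

  *-cancelˡ : ∀ {x} → x # 0# → ∀ {y z} → x * y ≈ x * z → y ≈ z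
  *-cancelˡ {x} x#0 {y} {z} xy≈xz with inverse x#0
  ... | x⁻¹ , x⁻¹x≈1 = begin
    y             ≈⟨ *-identityˡ y ⟨
    1# * y        ≈⟨ *-congʳ x⁻¹x≈1 ⟨
    x⁻¹ * x * y   ≈⟨ *-assoc _ _ _ ⟩
    x⁻¹ * (x * y) ≈⟨ *-congˡ xy≈xz ⟩
    x⁻¹ * (x * z) ≈⟨ *-assoc _ _ _ ⟨
    x⁻¹ * x * z   ≈⟨ *-congʳ x⁻¹x≈1 ⟩
    1# * z        ≈⟨ *-identityˡ z ⟩
    z             ∎

  *-pos-cancelˡ : ∀ {x y} → 0# <ᴿ x → 0# <ᴿ x * y → 0# <ᴿ y
  *-pos-cancelˡ {x} {y} 0<x 0<xy with inverse (>⇒# 0<x)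
  ... | x⁻¹ , x⁻¹x≈1 = <-respʳ x⁻¹xy≈y (*-pos 0<x⁻¹ 0<xy)
    where
    x⁻¹xy≈y : x⁻¹ * (x * y) ≈ y
    x⁻¹xy≈y = trans (sym (*-assoc _ _ _)) (trans (*-congʳ x⁻¹x≈1) (*-identityˡ y))
    x⁻¹#0 : x⁻¹ # 0#
    x⁻¹#0 = invertible⇒#
      ( x , trans (*-congˡ (x-0≈x x⁻¹)) (trans (*-comm _ _) x⁻¹x≈1)
          , trans (*-congʳ (x-0≈x x⁻¹)) x⁻¹x≈1 )
    -- x⁻¹ = x * (x⁻¹ * x⁻¹)
    0<x⁻¹ : 0# <ᴿ x⁻¹
    0<x⁻¹ = <-respʳ
      (trans (solve 2 (λ x y → x :* (y :* y) := y :* x :* y) refl x x⁻¹) (trans (*-congʳ x⁻¹x≈1) (*-identityˡ x⁻¹)))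
      (*-pos 0<x (square-pos x⁻¹#0))

  *-#0 : ∀ {x y} → x # 0# → y # 0# → x * y # 0#
  *-#0 = HeytingProperties.x#0y#0→xy#0 heytingCommutativeRing

  fromℕ-pos : ∀ n → 0# <ᴿ fromℕ (suc n)
  fromℕ-pos zero    = <-respʳ (sym (+-identityʳ 1#)) 0<1
  fromℕ-pos (suc n) = +-pos 0<1 (fromℕ-pos n)

  fromℕ-mono-< : ∀ {m n} → m ℕ.< n → fromℕ m <ᴿ fromℕ n
  fromℕ-mono-< {zero}  {suc n} _         = fromℕ-pos n
  fromℕ-mono-< {suc m} {suc n} (s≤s m<n) = +-monoʳ-< 1# (fromℕ-mono-< m<n)

  fromℕ-injective : ∀ {m n} → fromℕ m ≈ fromℕ n → m ≡ n
  fromℕ-injective {m} {n} eq with ℕ.<-cmp m n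
  ... | tri< m<n _ _ = contradiction (fromℕ-mono-< m<n) (<-irrefl eq)
  ... | tri≈ _ m≡n _ = m≡n
  ... | tri> _ _ n<m = contradiction (fromℕ-mono-< n<m) (<-irrefl (sym eq))

  fromℕ-cancel-< : ∀ {m n} → fromℕ m <ᴿ fromℕ n → m ℕ.< n
  fromℕ-cancel-< {m} {n} lt with ℕ.<-cmp m n
  ... | tri< m<n _ _ = m<n
  ... | tri≈ _ ≡.refl _ = contradiction lt (<-irrefl refl)
  ... | tri> _ _ n<m = contradiction lt (<-asym (fromℕ-mono-< n<m))

  -- The sign of x cannot be decided. Instead, a negative square would be invertible, which makes x
  -- invertible, hence apart from 0, and then its square is positive.
  square-nonneg : ∀ x → ¬ (x * x <ᴿ 0#)
  square-nonneg x x²<0 with inverse (<⇒# x²<0)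
  ... | y , yx²≈1 = <-asym x²<0 (square-pos (invertible⇒#
    ( y * x
    , trans (*-congˡ (x-0≈x x)) (trans (*-assoc _ _ _) yx²≈1)
    , trans (*-congʳ (x-0≈x x)) (trans (*-comm _ _) (trans (*-assoc _ _ _) yx²≈1)) )))

  square≈0 : ∀ {x} → x * x ≈ 0# → x ≈ 0#
  square≈0 {x} x²≈0 = proj₁ (tight x 0#) λ x#0 → <-irrefl (sym x²≈0) (square-pos x#0)

  open Summation semiring public

  private
    nonneg-+≈0 : ∀ {x y} → ¬ (x <ᴿ 0#) → ¬ (y <ᴿ 0#) → x + y ≈ 0# → x ≈ 0#
    nonneg-+≈0 {x} {y} x≮0 y≮0 x+y≈0 = ≤-antisym x≮0 λ 0<x →
      y≮0 (<-respʳ x+y≈0 (<-respˡ (+-identityˡ y) (<-respˡ (+-comm y 0#) (<-respʳ (+-comm y x) (+-monoʳ-< y 0<x)))))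

    nonneg-+ : ∀ {x y} → ¬ (x <ᴿ 0#) → ¬ (y <ᴿ 0#) → ¬ (x + y <ᴿ 0#)
    nonneg-+ {x} {y} x≮0 y≮0 x+y<0 = y≮0 (<-respˡ (trans (+-congʳ x≈0) (+-identityˡ y)) x+y<0)
      where
      x≈0 : x ≈ 0#
      x≈0 = ≤-antisym x≮0 λ 0<x → y≮0 (<-trans
        (<-respˡ (+-identityʳ y) (<-respʳ (+-comm y x) (+-monoʳ-< y 0<x))) x+y<0)

  opaque
    unfolding ∑

    nonneg-∑ : ∀ {n} (f : Fin n → Carrier) → (∀ i → ¬ (f i <ᴿ 0#)) → ¬ (∑ f <ᴿ 0#)
    nonneg-∑ {zero}  f f≮0 = <-irrefl refl
    nonneg-∑ {suc n} f f≮0 = nonneg-+ (f≮0 zero) (nonneg-∑ (f ∘ suc) (f≮0 ∘ suc))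

    nonneg-∑≈0 : ∀ {n} (f : Fin n → Carrier) → (∀ i → ¬ (f i <ᴿ 0#)) → ∑ f ≈ 0# → ∀ i → f i ≈ 0#
    nonneg-∑≈0 {suc n} f f≮0 eq zero    =
      nonneg-+≈0 (f≮0 zero) (nonneg-∑ (f ∘ suc) (f≮0 ∘ suc)) eq
    nonneg-∑≈0 {suc n} f f≮0 eq (suc i) = nonneg-∑≈0 (f ∘ suc) (f≮0 ∘ suc)
      (nonneg-+≈0 (nonneg-∑ (f ∘ suc) (f≮0 ∘ suc)) (f≮0 zero) (trans (+-comm _ _) eq)) i

  ∑-squares≈0 : ∀ {n} (f : Fin n → Carrier) → ∑ (λ i → f i * f i) ≈ 0# → ∀ i → f i ≈ 0#
  ∑-squares≈0 f eq i = square≈0 (nonneg-∑≈0 _ (λ i → square-nonneg (f i)) eq i)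

  opaque
    unfolding ∑ Counting.∑

    fromℕ-∑ : ∀ {n} (f : Fin n → ℕ) → fromℕ (Counting.∑ f) ≈ ∑ (λ i → fromℕ (f i))
    fromℕ-∑ {zero}  f = refl
    fromℕ-∑ {suc n} f = trans (fromℕ-+ (f zero) _) (+-congˡ (fromℕ-∑ (f ∘ suc)))

  fromℕ-𝟙 : ∀ {p} {P : Set p} (p? : Dec P) → fromℕ (Counting.𝟙 p?) ≈ 𝟙 p?
  fromℕ-𝟙 (yes _) = +-identityʳ 1#
  fromℕ-𝟙 (no _)  = refl

  fromℕ-∑-𝟙 : ∀ {n p} {P : Pred (Fin n) p} (P? : Decidable P) →
              fromℕ (Counting.∑ (λ i → Counting.𝟙 (P? i))) ≈ ∑ (λ i → 𝟙 (P? i))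
  fromℕ-∑-𝟙 P? = trans (fromℕ-∑ (λ i → Counting.𝟙 (P? i))) (∑-cong (λ i → fromℕ-𝟙 (P? i)))

-- Distances, and neighbour counts in a distance-regular graph.

module Distance (Γ : ConnectedGraph) where
  open ConnectedGraph Γ public renaming (sym to Adj-sym)

  walk-++ : ∀ {j k x y z} → Walk j x y → Walk k y z → Walk (j ℕ.+ k) x z
  walk-++ {zero}  ≡.refl        w′ = w′
  walk-++ {suc j} (u , adj , w) w′ = u , adj , walk-++ w w′

  walk-snoc : ∀ {k x y z} → Walk k x y → Adj y z → Walk (suc k) x z
  walk-snoc {zero}  ≡.refl        adj  = _ , adj , ≡.refl
  walk-snoc {suc k} (u , adj′ , w) adj = u , adj′ , walk-snoc w adj

  walk-sym : ∀ {k x y} → Walk k x y → Walk k y x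
  walk-sym {zero}  ≡.refl        = ≡.refl
  walk-sym {suc k} (u , adj , w) = walk-snoc (walk-sym w) (Adj-sym adj)

  d-walk : ∀ x y → Walk (d x y) x y
  d-walk x y = proj₁ (proj₂ (least (λ k → walk? adj? k x y) _ (proj₂ (connected x y))))

  d-min : ∀ {k x y} → Walk k x y → d x y ≤ k
  d-min {k} {x} {y} = proj₂ (proj₂ (least (λ k → walk? adj? k x y) _ (proj₂ (connected x y)))) k

  d-refl : ∀ x → d x x ≡ 0
  d-refl x = ℕ.n≤0⇒n≡0 (d-min {0} ≡.refl)

  d≡0⇒≡ : ∀ {x y} → d x y ≡ 0 → x ≡ y
  d≡0⇒≡ {x} {y} eq = ≡.subst (λ k → Walk k x y) eq (d-walk x y)

  d-sym : ∀ x y → d x y ≡ d y x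
  d-sym x y = ℕ.≤-antisym (d-min (walk-sym (d-walk y x))) (d-min (walk-sym (d-walk x y)))

  d-step : ∀ x {y z} → Adj y z → d x z ≤ suc (d x y)
  d-step x {y} adj = d-min (walk-snoc (d-walk x y) adj)

  d≡1⇒Adj : ∀ {x y} → d x y ≡ 1 → Adj x y
  d≡1⇒Adj {x} {y} eq with ≡.subst (λ k → Walk k x y) eq (d-walk x y)
  ... | _ , adj , ≡.refl = adj

  Adj⇒d≡1 : ∀ {x y} → Adj x y → d x y ≡ 1
  Adj⇒d≡1 {x} {y} adj with d x y in eq | d-min {1} (y , adj , ≡.refl)
  ... | 0 | _ = contradiction adj (irrefl (d≡0⇒≡ eq))
  ... | 1 | _ = ≡.refl
  ... | suc (suc _) | s≤s ()

  closer : ∀ {x y m} → d x y ≡ suc m → ∃ λ z → Adj y z × d x z ≡ m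
  closer {x} {y} {m} eq with ≡.subst (λ k → Walk k y x) eq (walk-sym (d-walk x y))
  ... | z , adj , w = z , adj , ℕ.≤-antisym (d-min (walk-sym w))
    (ℕ.≤-pred (≡.subst (_≤ suc (d x z)) eq (d-step x (Adj-sym adj))))

  reach : ∀ {x y m} → d x y ≡ m → ∀ i → i ≤ m → ∃ λ z → d x z ≡ i
  reach {x} {y} {zero}  eq zero z≤n = y , eq
  reach {x} {y} {suc m} eq i i≤1+m with ℕ.m≤n⇒m<n∨m≡n i≤1+m
  ... | inj₂ ≡.refl = y , eq
  ... | inj₁ i<1+m with closer eq
  ...   | z , _ , eq′ = reach eq′ i (ℕ.≤-pred i<1+m)

  d-adjacent : ∀ x {y z} → Adj y z → d x z ≡ d x y ⊎ d x z ≡ suc (d x y) ⊎ suc (d x z) ≡ d x y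
  d-adjacent x {y} {z} adj with ℕ.<-cmp (d x z) (d x y)
  ... | tri< lt _ _ = inj₂ (inj₂ (ℕ.≤-antisym lt (d-step x (Adj-sym adj))))
  ... | tri≈ _ eq _ = inj₁ eq
  ... | tri> _ _ gt = inj₂ (inj₁ (ℕ.≤-antisym (d-step x adj) gt))

  module Regular {bᵢ cᵢ : ℕ → ℕ} (regular : IsDistanceRegular bᵢ cᵢ) where
    open IsDistanceRegular regular
    open Counting

    further? : ∀ x y z → Dec (Adj y z × d x z ≡ suc (d x y))
    further? x y z = adj? y z ×-dec (d x z ℕ.≟ suc (d x y))

    closer? : ∀ x y z → Dec (Adj y z × suc (d x z) ≡ d x y)
    closer? x y z = adj? y z ×-dec (suc (d x z) ℕ.≟ d x y)

    ∑-further : ∀ x y → ∑ (λ z → 𝟙 (further? x y z)) ≡ bᵢ (d x y)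
    ∑-further x y = ≡.trans (≡.sym (count≡∑ (further? x y) id)) (b-count x y)

    ∑-closer : ∀ x y → ∑ (λ z → 𝟙 (closer? x y z)) ≡ cᵢ (d x y)
    ∑-closer x y = ≡.trans (≡.sym (count≡∑ (closer? x y) id)) (c-count x y)

    valency : ∀ y → ∑ (λ z → 𝟙 (adj? y z)) ≡ bᵢ 0
    valency y = ≡.trans
      (∑-cong λ z → 𝟙-⇔ (adj? y z) (further? y y z)
        (λ adj → adj , ≡.trans (Adj⇒d≡1 adj) (≡.cong suc (≡.sym (d-refl y)))) proj₁)
      (≡.trans (∑-further y y) (≡.cong bᵢ (d-refl y)))

    -- The formulas for classical parameters leave out `cᵢ 0` and `bᵢ D`. The neighbour counts
    -- themselves force both to be 0, which extends the formulas to the ends of the range.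
    c₀≡0 : Vertex → cᵢ 0 ≡ 0
    c₀≡0 x = ≡.trans (≡.cong cᵢ (≡.sym (d-refl x)))
      (≡.trans (≡.sym (∑-closer x x)) (∑-zero λ z → 𝟙-false (closer? x x z)
        λ (_ , eq) → ℕ.1+n≢0 (≡.trans eq (d-refl x))))

    module _ {D : ℕ} (diameter : HasDiameter D) where
      b-diameter≡0 : bᵢ D ≡ 0
      b-diameter≡0 with proj₂ diameter
      ... | x , y , ≡.refl = ≡.trans (≡.sym (∑-further x y)) (∑-zero λ z → 𝟙-false (further? x y z)
        λ (_ , eq) → ℕ.1+n≰n (≡.subst (_≤ D) eq (proj₁ diameter x z)))

      private
        adjacent-at : ∀ {i} → i < D → ∃ λ x → ∃ λ y → ∃ λ z → Adj y z × d x y ≡ suc i × d x z ≡ i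
        adjacent-at {i} i<D with proj₂ diameter
        ... | x , y , eq with reach eq (suc i) i<D
        ...   | y′ , eq′ with closer eq′
        ...     | z , adj , eq″ = x , y′ , z , adj , eq′ , eq″

      b-pos : ∀ {i} → i < D → 1 ≤ bᵢ i
      b-pos i<D with adjacent-at i<D
      ... | x , y , z , adj , dy , ≡.refl =
        ≡.subst (1 ≤_) (∑-further x z) (∑-𝟙-pos (further? x z) y (Adj-sym adj , dy))

      c-pos : ∀ {i} → i < D → 1 ≤ cᵢ (suc i)
      c-pos i<D with adjacent-at i<D
      ... | x , y , z , adj , dy , dz =
        ≡.subst (1 ≤_) (≡.trans (∑-closer x y) (≡.cong cᵢ dy))
          (∑-𝟙-pos (closer? x y) z (adj , ≡.trans (≡.cong suc dz) (≡.sym dy)))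

-- The adjacency matrix on functions of the distance from a vertex.

module Radial {c ℓ₁ ℓ₂} (ℝ : RealNumbers c ℓ₁ ℓ₂) (Γ : ConnectedGraph) {bᵢ cᵢ : ℕ → ℕ}
              (regular : ConnectedGraph.IsDistanceRegular Γ bᵢ cᵢ) where
  open RealProperties ℝ
  open Distance Γ
  open Regular regular
  open SetoidReasoning setoid
  open Solver using (solve; _:=_; _:+_; _:*_; _:-_; :-_; con)

  A : Vertex → Vertex → Carrier
  A = adjacencyMatrix ℝ Γ

  -- This is the three-term operator with coefficients c_i, a_i = k - b_i - c_i and b_i, arranged in
  -- differences so that a_i does not have to be named. At i = 0 the last difference is zero because
  -- `pred 0` is 0.
  radial : (ℕ → Carrier) → ℕ → Carrier
  radial f i = fromℕ (bᵢ 0) * f i + fromℕ (bᵢ i) * (f (suc i) - f i) + fromℕ (cᵢ i) * (f (pred i) - f i)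

  -- Each neighbour z of y is first charged the value `f i` with i = d x y; the farther and the
  -- closer neighbours then correct this value by the two differences.
  radial-adjacency : (f : ℕ → Carrier) → ∀ x y →
                     ∑ (λ z → A y z * f (d x z)) ≈ radial f (d x y)
  radial-adjacency f x y = begin
    ∑ (λ z → A y z * f (d x z))
      ≈⟨ ∑-cong pointwise ⟩
    ∑ (λ z → A y z * f i + B z * (f (suc i) - f i) + C z * (f (pred i) - f i))
      ≈⟨ ∑-+ _ _ ⟩
    ∑ (λ z → A y z * f i + B z * (f (suc i) - f i)) + ∑ (λ z → C z * (f (pred i) - f i))
      ≈⟨ +-congʳ (∑-+ _ _) ⟩
    ∑ (λ z → A y z * f i) + ∑ (λ z → B z * (f (suc i) - f i)) + ∑ (λ z → C z * (f (pred i) - f i))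
      ≈⟨ +-cong (+-cong (∑-*ʳ _ _) (∑-*ʳ _ _)) (∑-*ʳ _ _) ⟩
    ∑ (A y) * f i + ∑ B * (f (suc i) - f i) + ∑ C * (f (pred i) - f i)
      ≈⟨ +-cong (+-cong (*-congʳ ΣA) (*-congʳ ΣB)) (*-congʳ ΣC) ⟩
    radial f i ∎
    where
    i = d x y
    B C : Vertex → Carrier
    B z = 𝟙 (further? x y z)
    C z = 𝟙 (closer? x y z)
    ΣA : ∑ (A y) ≈ fromℕ (bᵢ 0)
    ΣA = trans (sym (fromℕ-∑-𝟙 (adj? y))) (reflexive (≡.cong fromℕ (valency y)))
    ΣB : ∑ B ≈ fromℕ (bᵢ i)
    ΣB = trans (sym (fromℕ-∑-𝟙 (further? x y))) (reflexive (≡.cong fromℕ (∑-further x y)))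
    ΣC : ∑ C ≈ fromℕ (cᵢ i)
    ΣC = trans (sym (fromℕ-∑-𝟙 (closer? x y))) (reflexive (≡.cong fromℕ (∑-closer x y)))
    0′ 1′ : ∀ {n} → Solver.Polynomial n
    0′ = con (+ 0)
    1′ = con (+ 1)
    -- The values of the indicators arrive as equations and are matched away, so that each of the
    -- four cases is left with one ring identity.
    expand : ∀ {a b c g} z → A y z ≡ a → B z ≡ b → C z ≡ c → f (d x z) ≡ g →
             a * g ≈ a * f i + b * (f (suc i) - f i) + c * (f (pred i) - f i) →
             A y z * f (d x z) ≈ A y z * f i + B z * (f (suc i) - f i) + C z * (f (pred i) - f i)
    expand z ≡.refl ≡.refl ≡.refl ≡.refl eq = eq
    pointwise : ∀ z → A y z * f (d x z) ≈ A y z * f i + B z * (f (suc i) - f i) + C z * (f (pred i) - f i)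
    pointwise z = split (adj? y z)
      where
      split : Dec (Adj y z) → _
      split (no ¬adj) = expand z (𝟙-false (adj? y z) ¬adj) (𝟙-false (further? x y z) (¬adj ∘ proj₁))
          (𝟙-false (closer? x y z) (¬adj ∘ proj₁)) ≡.refl
          (solve 4 (λ g f₀ f₁ f₂ → 0′ :* g := 0′ :* f₀ :+ 0′ :* (f₁ :- f₀) :+ 0′ :* (f₂ :- f₀)) refl _ _ _ _)
      split (yes adj) with d-adjacent x adj
      ... | inj₁ same = expand z (𝟙-true (adj? y z) adj)
            (𝟙-false (further? x y z) λ (_ , eq) → ℕ.1+n≢n (≡.trans (≡.sym eq) same))
            (𝟙-false (closer? x y z) λ (_ , eq) → ℕ.1+n≢n (≡.trans eq (≡.sym same)))
            (≡.cong f same)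
            (solve 3 (λ f₀ f₁ f₂ → 1′ :* f₀ := 1′ :* f₀ :+ 0′ :* (f₁ :- f₀) :+ 0′ :* (f₂ :- f₀)) refl _ _ _)
      ... | inj₂ (inj₁ further) = expand z (𝟙-true (adj? y z) adj)
            (𝟙-true (further? x y z) (adj , further))
            (𝟙-false (closer? x y z) λ (_ , eq) → ℕ.m≢1+n+m i (≡.trans (≡.sym eq) (≡.cong suc further)))
            (≡.cong f further)
            (solve 3 (λ f₀ f₁ f₂ → 1′ :* f₁ := 1′ :* f₀ :+ 1′ :* (f₁ :- f₀) :+ 0′ :* (f₂ :- f₀)) refl _ _ _)
      ... | inj₂ (inj₂ closer) = expand z (𝟙-true (adj? y z) adj)
            (𝟙-false (further? x y z) λ (_ , eq) → ℕ.m≢1+n+m i (≡.trans (≡.sym closer) (≡.cong suc eq)))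
            (𝟙-true (closer? x y z) (adj , closer))
            (≡.cong (f ∘ pred) closer)
            (solve 3 (λ f₀ f₁ f₂ → 1′ :* f₂ := 1′ :* f₀ :+ 0′ :* (f₁ :- f₀) :+ 1′ :* (f₂ :- f₀)) refl _ _ _)

-- The numbers [j] as natural numbers.

-- Horner's rule for 1 + b + ... + b^(j-1), which replaces the division in `qint`.
gauss : ℕ → ℕ → ℕ
gauss b zero    = 0
gauss b (suc j) = suc (b ℕ.* gauss b j)

-- With b = n + 2 and b - 1 = n + 1 this is b^j = 1 + [j] (b - 1), the form in which the division in
-- `qint` is visibly exact.
^≡gauss : ∀ n j → (+ suc (suc n)) ℤ.^ j ≡ + suc (gauss (suc (suc n)) j ℕ.* suc n)
^≡gauss n zero    = ≡.refl
^≡gauss n (suc j) = ≡.trans (≡.cong (+ suc (suc n) ℤ.*_) (^≡gauss n j))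
  (≡.trans (≡.sym (ℤ.pos-* (suc (suc n)) (suc (gauss (suc (suc n)) j ℕ.* suc n)))) (≡.cong +_
    (solve 2 (λ n g → (con 2 :+ n) :* (con 1 :+ g :* (con 1 :+ n))
                    := con 1 :+ (con 1 :+ (con 2 :+ n) :* g) :* (con 1 :+ n)) ≡.refl n (gauss (suc (suc n)) j))))
  where
  open +-*-Solver

qint≡gauss : ∀ n .{{_ : ℤ.NonZero (+ suc (suc n) ℤ.- 1ℤ)}} j →
             qint (+ suc (suc n)) j ≡ + gauss (suc (suc n)) j
qint≡gauss n j = ≡.trans (≡.cong (λ x → (x ℤ.- 1ℤ) ℤ./ + suc n) (^≡gauss n j))
  (≡.trans (ℤ.div-pos-is-/ℕ (+ (gauss (suc (suc n)) j ℕ.* suc n)) (suc n))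
    (≡.cong +_ (ℕ.m*n/n≡m (gauss (suc (suc n)) j) (suc n))))

gauss-< : ∀ n {i j} → i < j → gauss (suc n) i < gauss (suc n) j
gauss-< n {zero}  {suc j} _         = s≤s z≤n
gauss-< n {suc i} {suc j} (s≤s i<j) = s≤s (ℕ.*-monoʳ-< (suc n) (gauss-< n i<j))

-- The smallest eigenvalue for classical parameters.

module Spectrum {c ℓ₁ ℓ₂} (ℝ : RealNumbers c ℓ₁ ℓ₂) (Γ : ConnectedGraph) {bᵢ cᵢ : ℕ → ℕ}
                (regular : ConnectedGraph.IsDistanceRegular Γ bᵢ cᵢ)
                (n : ℕ) .{{_ : ℤ.NonZero (+ suc (suc n) ℤ.- 1ℤ)}} {D : ℕ} {α β : RealNumbers.Carrier ℝ}
                (classical : HasClassicalParameters ℝ Γ bᵢ cᵢ D (+ suc (suc n)) α β) (0<D : 0 < D) where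
  open RealProperties ℝ
  open Distance Γ
  open Regular regular
  open Radial ℝ Γ regular
  open HasClassicalParameters classical using (diameter; b-formula; c-formula)
  open SetoidReasoning setoid
  open Solver using (solve; _:=_; _:+_; _:*_; _:-_; :-_; con)

  q : ℕ → Carrier
  q i = fromℕ (gauss (suc (suc n)) i)

  r : Carrier
  r = q D

  private
    []≡q : ∀ i → fromℤ (qint (+ suc (suc n)) i) ≡ q i
    []≡q i = ≡.cong fromℤ (qint≡gauss n i)

    0′ 1′ : ∀ {n} → Solver.Polynomial n
    0′ = con (+ 0)
    1′ = con (+ 1)

    vertex : Vertex
    vertex = proj₁ (proj₂ diameter)

  b≈ : ∀ {i} → i ≤ D → fromℕ (bᵢ i) ≈ (r - q i) * (β - α * q i)
  b≈ {i} i≤D with ℕ.m≤n⇒m<n∨m≡n i≤D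
  ... | inj₁ i<D = ≡.subst₂ (λ x y → fromℕ (bᵢ i) ≈ (x - y) * (β - α * y)) ([]≡q D) ([]≡q i) (b-formula i i<D)
  ... | inj₂ ≡.refl = trans (reflexive (≡.cong fromℕ (b-diameter≡0 diameter)))
    (solve 3 (λ r α β → 0′ := (r :- r) :* (β :- α :* r)) refl r α β)

  c≈ : ∀ {i} → i ≤ D → fromℕ (cᵢ i) ≈ q i * (1# + α * q (pred i))
  c≈ {zero}  _   = trans (reflexive (≡.cong fromℕ (c₀≡0 vertex))) (sym (zeroˡ _))
  c≈ {suc i} i<D = ≡.subst₂ (λ x y → fromℕ (cᵢ (suc i)) ≈ x * (1# + α * y)) ([]≡q (suc i)) ([]≡q i) (c-formula i i<D)

  k≈ : fromℕ (bᵢ 0) ≈ r * β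
  k≈ = trans (b≈ z≤n) (solve 3 (λ r α β → (r :- 0′) :* (β :- α :* 0′) := r :* β) refl r α β)

  fromℕ-≥1 : ∀ {m} → 1 ≤ m → 0# <ᴿ fromℕ m
  fromℕ-≥1 {suc m} _ = fromℕ-pos m

  -- Below the diameter `bᵢ i` is a positive count and r - [i] is positive, so the remaining factor
  -- of `bᵢ i` is positive as well. `1+αq-pos` follows from `cᵢ` in the same way.
  β-αq-pos : ∀ {i} → i < D → 0# <ᴿ β - α * q i
  β-αq-pos i<D = *-pos-cancelˡ (0<y-x (fromℕ-mono-< (gauss-< (suc n) i<D)))
    (<-respʳ (b≈ (ℕ.<⇒≤ i<D)) (fromℕ-≥1 (b-pos diameter i<D)))

  1+αq-pos : ∀ {i} → i < D → 0# <ᴿ 1# + α * q i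
  1+αq-pos {i} i<D = *-pos-cancelˡ (fromℕ-≥1 {gauss (suc (suc n)) (suc i)} (s≤s z≤n)) (<-respʳ (c≈ i<D) (fromℕ-≥1 (c-pos diameter i<D)))

  -- - ρ i is the ratio w (i + 1) / w i of consecutive entries of the eigenvector
  -- below; it carries no information for i ≥ D.
  ρ-with : ∀ i → Dec (i < D) → Carrier
  ρ-with i (yes i<D) = (1# + α * q i) * proj₁ (inverse (>⇒# (β-αq-pos i<D)))
  ρ-with i (no _)    = 0#

  ρ-with≈ : ∀ {i} (i<D? : Dec (i < D)) → i < D → ρ-with i i<D? * (β - α * q i) ≈ 1# + α * q i
  ρ-with≈ (yes i<D) _   = trans (*-assoc _ _ _)
    (trans (*-congˡ (proj₂ (inverse (>⇒# (β-αq-pos i<D))))) (*-identityʳ _))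
  ρ-with≈ (no i≮D)  i<D = contradiction i<D i≮D

  opaque
    ρ : ℕ → Carrier
    ρ i = ρ-with i (i ℕ.<? D)

    ρ≈ : ∀ {i} → i < D → ρ i * (β - α * q i) ≈ 1# + α * q i
    ρ≈ {i} = ρ-with≈ (i ℕ.<? D)

  ρ-pos : ∀ {i} → i < D → 0# <ᴿ ρ i
  ρ-pos i<D = *-pos-cancelˡ (β-αq-pos i<D) (<-respʳ (sym (trans (*-comm _ _) (ρ≈ i<D))) (1+αq-pos i<D))

  w : ℕ → Carrier
  w zero    = 1#
  w (suc i) = - ρ i * w i

  -‿#0 : ∀ {x} → 0# <ᴿ x → - x # 0#
  -‿#0 {x} 0<x = <⇒# (0<y-x⇒x<y (<-respʳ (solve 1 (λ x → x := 0′ :- :- x) refl x) 0<x))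

  w#0 : ∀ {i} → i ≤ D → w i # 0#
  w#0 {zero}  _   = 1#0
  w#0 {suc i} i<D = *-#0 (-‿#0 (ρ-pos i<D)) (w#0 (ℕ.<⇒≤ i<D))

  private
    -- The factor β - α [i] of `bᵢ i` cancels the denominator of `ρ i`. At i = D both sides vanish,
    -- since `bᵢ D` is 0 and r = [D].
    b*w : ∀ {i} → i ≤ D → fromℕ (bᵢ i) * w (suc i) ≈ - ((r - q i) * (1# + α * q i)) * w i
    b*w {i} i≤D with ℕ.m≤n⇒m<n∨m≡n i≤D
    ... | inj₁ i<D = begin
      fromℕ (bᵢ i) * (- ρ i * w i)                        ≈⟨ *-congʳ (b≈ i≤D) ⟩
      (r - q i) * (β - α * q i) * (- ρ i * w i)           ≈⟨ solve 4 (λ a b ρ w → a :* b :* (:- ρ :* w) := :- (a :* (ρ :* b)) :* w) refl (r - q i) (β - α * q i) (ρ i) (w i) ⟩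
      - ((r - q i) * (ρ i * (β - α * q i))) * w i         ≈⟨ *-congʳ (-‿cong (*-congˡ (ρ≈ i<D))) ⟩
      - ((r - q i) * (1# + α * q i)) * w i                ∎
    ... | inj₂ ≡.refl = trans (*-congʳ (reflexive (≡.cong fromℕ (b-diameter≡0 diameter))))
      (solve 4 (λ r a w w′ → 0′ :* w′ := :- ((r :- r) :* a) :* w) refl r (1# + α * r) (w D) (w (suc D)))

    -- Here the ratio is read backwards: the factor 1 + α [i] of `cᵢ (suc i)` is ρ i (β - α [i]),
    -- and ρ i w_i is - w_{i+1}.
    c*w : ∀ {i} → i ≤ D → fromℕ (cᵢ i) * w (pred i) ≈ - (q i * (β - α * q (pred i))) * w i
    c*w {zero}  _   = trans (*-congʳ (reflexive (≡.cong fromℕ (c₀≡0 vertex))))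
      (solve 2 (λ a w → 0′ :* w := :- (0′ :* a) :* w) refl (β - α * 0#) 1#)
    c*w {suc i} i<D = begin
      fromℕ (cᵢ (suc i)) * w i                            ≈⟨ *-congʳ (c≈ i<D) ⟩
      q (suc i) * (1# + α * q i) * w i                    ≈⟨ *-congʳ (*-congˡ (ρ≈ i<D)) ⟨
      q (suc i) * (ρ i * (β - α * q i)) * w i             ≈⟨ solve 4 (λ a b ρ w → a :* (ρ :* b) :* w := :- (a :* b) :* (:- ρ :* w)) refl (q (suc i)) (β - α * q i) (ρ i) (w i) ⟩
      - (q (suc i) * (β - α * q i)) * (- ρ i * w i)       ∎

  -- In the coefficient of w_i the parts with α cancel. What is subtracted from k is (r - [i]) (1 +
  -- β) + [i] (1 + β) = r (1 + β), and k = r β leaves - r.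
  radial-w : ∀ {i} → i ≤ D → radial w i ≈ - r * w i
  radial-w {i} i≤D = begin
    k * w₀ + b * (w₁ - w₀) + c′ * (w₂ - w₀)
      ≈⟨ solve 6 (λ k b c w₀ w₁ w₂ → k :* w₀ :+ b :* (w₁ :- w₀) :+ c :* (w₂ :- w₀)
                   := (k :* w₀ :- b :* w₀ :- c :* w₀) :+ (b :* w₁ :+ c :* w₂)) refl k b c′ w₀ w₁ w₂ ⟩
    (k * w₀ - b * w₀ - c′ * w₀) + (b * w₁ + c′ * w₂)
      ≈⟨ +-cong (+-cong (+-cong (*-congʳ k≈) (-‿cong (*-congʳ (b≈ i≤D)))) (-‿cong (*-congʳ (c≈ i≤D))))
                (+-cong (b*w i≤D) (c*w i≤D)) ⟩
    (r * β * w₀ - (r - q i) * (β - α * q i) * w₀ - q i * (1# + α * q (pred i)) * w₀)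
      + (- ((r - q i) * (1# + α * q i)) * w₀ + - (q i * (β - α * q (pred i))) * w₀)
      ≈⟨ solve 6 (λ r β α p p′ w → (r :* β :* w :- (r :- p) :* (β :- α :* p) :* w :- p :* (1′ :+ α :* p′) :* w)
           :+ (:- ((r :- p) :* (1′ :+ α :* p)) :* w :+ :- (p :* (β :- α :* p′)) :* w) := :- r :* w)
           refl r β α (q i) (q (pred i)) w₀ ⟩
    - r * w₀ ∎
    where
    k = fromℕ (bᵢ 0)
    b = fromℕ (bᵢ i)
    c′ = fromℕ (cᵢ i)
    w₀ = w i
    w₁ = w (suc i)
    w₂ = w (pred i)

  adjacency-w : ∀ x y → ∑ (λ z → A y z * w (d x z)) ≈ - r * w (d x y)
  adjacency-w x y = trans (radial-adjacency w x y) (radial-w (proj₁ diameter x y))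

  eigenvalue-minus-r : IsEigenvalue ℝ Γ (- r)
  eigenvalue-minus-r = (λ y → w (d vertex y)) , (vertex , w#0 (proj₁ diameter vertex vertex))
    , λ y → trans (reflexive (≡.sym (∑≡sum _))) (adjacency-w vertex y)

  module _ {θ : Carrier} (eigenvalue : IsEigenvalue ℝ Γ θ) (θ<-r : θ <ᴿ - r) where
    private
      v : Vertex → Carrier
      v = proj₁ eigenvalue
      x : Vertex
      x = proj₁ (proj₁ (proj₂ eigenvalue))

      -- The factor `v x` makes the value at x a square, hence positive, for either sign of `v x`.
      u : Vertex → Carrier
      u y = v x * v y

      A-sym : ∀ y z → A y z ≡ A z y
      A-sym y z = 𝟙-⇔ (adj? y z) (adj? z y) Adj-sym Adj-sym

      adjacency-u : ∀ z → ∑ (λ y → u y * A y z) ≈ θ * u z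
      adjacency-u z = begin
        ∑ (λ y → u y * A y z)         ≈⟨ ∑-cong (λ y → trans (*-congˡ (reflexive (A-sym y z)))
                                           (solve 3 (λ a b c → a :* b :* c := a :* (c :* b)) refl (v x) (v y) (A z y))) ⟩
        ∑ (λ y → v x * (A z y * v y)) ≈⟨ ∑-*ˡ (v x) (λ y → A z y * v y) ⟩
        v x * ∑ (λ y → A z y * v y)   ≈⟨ *-congˡ (trans (reflexive (∑≡sum _)) (proj₂ (proj₂ eigenvalue) z)) ⟩
        v x * (θ * v z)               ≈⟨ solve 3 (λ a b c → a :* (b :* c) := b :* (a :* c)) refl (v x) θ (v z) ⟩
        θ * u z                       ∎

      φ : (ℕ → Carrier) → Carrier
      φ f = ∑ (λ y → u y * f (d x y))

      φ-cong : ∀ {f g} → (∀ {i} → i ≤ D → f i ≈ g i) → φ f ≈ φ g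
      φ-cong f≈g = ∑-cong λ y → *-congˡ (f≈g (proj₁ diameter x y))

      φ-+ : ∀ f g → φ (λ i → f i + g i) ≈ φ f + φ g
      φ-+ f g = trans (∑-cong λ y → distribˡ _ _ _) (∑-+ _ _)

      φ-* : ∀ f a → φ (λ i → f i * a) ≈ φ f * a
      φ-* f a = trans (∑-cong λ y → sym (*-assoc _ _ _)) (∑-*ʳ a _)

      -- The adjacency matrix is symmetric, so it can be moved from f to the eigenvector, where it
      -- acts as θ.
      φ-radial : ∀ f → φ (radial f) ≈ θ * φ f
      φ-radial f = begin
        ∑ (λ y → u y * radial f (d x y))                 ≈⟨ ∑-cong (λ y → *-congˡ (radial-adjacency f x y)) ⟨
        ∑ (λ y → u y * ∑ (λ z → A y z * f (d x z)))      ≈⟨ ∑-cong (λ y → ∑-*ˡ (u y) (λ z → A y z * f (d x z))) ⟨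
        ∑ (λ y → ∑ (λ z → u y * (A y z * f (d x z))))    ≈⟨ ∑-swap (λ y z → u y * (A y z * f (d x z))) ⟩
        ∑ (λ z → ∑ (λ y → u y * (A y z * f (d x z))))    ≈⟨ ∑-cong (λ z → ∑-cong (λ y → sym (*-assoc _ _ _))) ⟩
        ∑ (λ z → ∑ (λ y → u y * A y z * f (d x z)))      ≈⟨ ∑-cong (λ z → trans (∑-*ʳ (f (d x z)) (λ y → u y * A y z)) (trans (*-congʳ (adjacency-u z)) (*-assoc _ _ _))) ⟩
        ∑ (λ z → θ * (u z * f (d x z)))                  ≈⟨ ∑-*ˡ θ (λ z → u z * f (d x z)) ⟩
        θ * φ f                                          ∎

      δ : ℕ → ℕ → Carrier
      δ j i = 𝟙 (i ℕ.≟ j)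

      truncated : ℕ → ℕ → Carrier
      truncated j i = 𝟙 (i ℕ.≤? j) * w i

      expand : ∀ {i j t₀ t₁ t₂ d₀ d₁} →
               𝟙 (i ℕ.≤? j) ≡ t₀ → 𝟙 (suc i ℕ.≤? j) ≡ t₁ → 𝟙 (pred i ℕ.≤? j) ≡ t₂ →
               δ j i ≡ d₀ → δ (suc j) i ≡ d₁ →
               fromℕ (bᵢ 0) * (t₀ * w i) + fromℕ (bᵢ i) * (t₁ * w (suc i) - t₀ * w i)
                 + fromℕ (cᵢ i) * (t₂ * w (pred i) - t₀ * w i)
               ≈ t₀ * w i * - r + (d₀ * - (fromℕ (bᵢ j) * w (suc j)) + d₁ * (fromℕ (cᵢ (suc j)) * w j)) →
               radial (truncated j) i ≈
               truncated j i * - r + (δ j i * - (fromℕ (bᵢ j) * w (suc j)) + δ (suc j) i * (fromℕ (cᵢ (suc j)) * w j))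
      expand ≡.refl ≡.refl ≡.refl ≡.refl ≡.refl eq = eq

      -- Cutting w off after j disturbs the recurrence only at the two sides of the cut: position j
      -- loses its term from j + 1, and position j + 1 receives a term from j.
      radial-truncated : ∀ {j i} → i ≤ D → radial (truncated j) i ≈
        truncated j i * - r + (δ j i * - (fromℕ (bᵢ j) * w (suc j)) + δ (suc j) i * (fromℕ (cᵢ (suc j)) * w j))
      radial-truncated {j} {i} i≤D with ℕ.<-cmp i j
      ... | tri< i<j i≢j _ = expand (𝟙-true (i ℕ.≤? j) (ℕ.<⇒≤ i<j)) (𝟙-true (suc i ℕ.≤? j) i<j)
              (𝟙-true (pred i ℕ.≤? j) (ℕ.≤-trans ℕ.pred[n]≤n (ℕ.<⇒≤ i<j)))
              (𝟙-false (i ℕ.≟ j) i≢j) (𝟙-false (i ℕ.≟ suc j) (ℕ.<⇒≢ (ℕ.m<n⇒m<1+n i<j)))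
              (begin
                k * (1# * w₀) + b * (1# * w₁ - 1# * w₀) + c′ * (1# * w₂ - 1# * w₀)
                  ≈⟨ solve 6 (λ k b c w₀ w₁ w₂ →
                       k :* (1′ :* w₀) :+ b :* (1′ :* w₁ :- 1′ :* w₀) :+ c :* (1′ :* w₂ :- 1′ :* w₀)
                       := k :* w₀ :+ b :* (w₁ :- w₀) :+ c :* (w₂ :- w₀)) refl k b c′ w₀ w₁ w₂ ⟩
                radial w i
                  ≈⟨ radial-w i≤D ⟩
                - r * w₀
                  ≈⟨ solve 4 (λ r w x y → :- r :* w := 1′ :* w :* :- r :+ (0′ :* x :+ 0′ :* y)) refl r w₀ X Y ⟩
                1# * w₀ * - r + (0# * X + 0# * Y) ∎)
        where
        X = - (fromℕ (bᵢ j) * w (suc j))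
        Y = fromℕ (cᵢ (suc j)) * w j
        k = fromℕ (bᵢ 0)
        b = fromℕ (bᵢ i)
        c′ = fromℕ (cᵢ i)
        w₀ = w i
        w₁ = w (suc i)
        w₂ = w (pred i)
      ... | tri≈ _ ≡.refl _ = expand (𝟙-true (i ℕ.≤? i) ℕ.≤-refl) (𝟙-false (suc i ℕ.≤? i) ℕ.1+n≰n)
              (𝟙-true (pred i ℕ.≤? i) ℕ.pred[n]≤n)
              (𝟙-true (i ℕ.≟ i) ≡.refl) (𝟙-false (i ℕ.≟ suc i) (ℕ.1+n≢n ∘ ≡.sym))
              (begin
                k * (1# * w₀) + b * (0# * w₁ - 1# * w₀) + c′ * (1# * w₂ - 1# * w₀)
                  ≈⟨ solve 6 (λ k b c w₀ w₁ w₂ →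
                       k :* (1′ :* w₀) :+ b :* (0′ :* w₁ :- 1′ :* w₀) :+ c :* (1′ :* w₂ :- 1′ :* w₀)
                       := k :* w₀ :+ b :* (w₁ :- w₀) :+ c :* (w₂ :- w₀) :- b :* w₁) refl k b c′ w₀ w₁ w₂ ⟩
                radial w i - b * w₁
                  ≈⟨ +-congʳ (radial-w i≤D) ⟩
                - r * w₀ - b * w₁
                  ≈⟨ solve 4 (λ r w x y → :- r :* w :- x := 1′ :* w :* :- r :+ (1′ :* :- x :+ 0′ :* y)) refl r w₀ (b * w₁) Y ⟩
                1# * w₀ * - r + (1# * - (b * w₁) + 0# * Y) ∎)
        where
        Y = fromℕ (cᵢ (suc i)) * w i
        k = fromℕ (bᵢ 0)
        b = fromℕ (bᵢ i)
        c′ = fromℕ (cᵢ i)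
        w₀ = w i
        w₁ = w (suc i)
        w₂ = w (pred i)
      ... | tri> _ i≢j j<i with ℕ.m≤n⇒m<n∨m≡n j<i
      ...   | inj₂ ≡.refl = expand (𝟙-false (suc j ℕ.≤? j) ℕ.1+n≰n) (𝟙-false (suc (suc j) ℕ.≤? j) (ℕ.1+n≰n ∘ ℕ.<⇒≤))
                (𝟙-true (j ℕ.≤? j) ℕ.≤-refl) (𝟙-false (suc j ℕ.≟ j) i≢j) (𝟙-true (suc j ℕ.≟ suc j) ≡.refl)
                (solve 8 (λ k b c w₀ w₁ w₂ r x →
                       k :* (0′ :* w₀) :+ b :* (0′ :* w₁ :- 0′ :* w₀) :+ c :* (1′ :* w₂ :- 0′ :* w₀)
                       := 0′ :* w₀ :* :- r :+ (0′ :* x :+ 1′ :* (c :* w₂))) refl _ _ _ _ _ _ _ _)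
      ...   | inj₁ 1+j<i = expand (𝟙-false (i ℕ.≤? j) (ℕ.<⇒≱ j<i)) (𝟙-false (suc i ℕ.≤? j) (ℕ.<⇒≱ (ℕ.m<n⇒m<1+n j<i)))
                (𝟙-false (pred i ℕ.≤? j) (ℕ.<⇒≱ (ℕ.<⇒≤pred 1+j<i)))
                (𝟙-false (i ℕ.≟ j) i≢j) (𝟙-false (i ℕ.≟ suc j) (ℕ.<⇒≢ 1+j<i ∘ ≡.sym))
                (solve 9 (λ k b c w₀ w₁ w₂ r x y →
                       k :* (0′ :* w₀) :+ b :* (0′ :* w₁ :- 0′ :* w₀) :+ c :* (0′ :* w₂ :- 0′ :* w₀)
                       := 0′ :* w₀ :* :- r :+ (0′ :* x :+ 0′ :* y)) refl _ _ _ _ _ _ _ _ _)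

      step : ∀ {i j t t′ d} → 𝟙 (i ℕ.≤? suc j) ≡ t → 𝟙 (i ℕ.≤? j) ≡ t′ → δ (suc j) i ≡ d →
             t * w i ≈ t′ * w i + d * w (suc j) →
             truncated (suc j) i ≈ truncated j i + δ (suc j) i * w (suc j)
      step ≡.refl ≡.refl ≡.refl eq = eq

      truncated-suc : ∀ j i → truncated (suc j) i ≈ truncated j i + δ (suc j) i * w (suc j)
      truncated-suc j i with ℕ.<-cmp i (suc j)
      ... | tri< (s≤s i≤j) i≢1+j _ = step {i} {j} (𝟙-true (i ℕ.≤? suc j) (ℕ.m≤n⇒m≤1+n i≤j)) (𝟙-true (i ℕ.≤? j) i≤j)
              (𝟙-false (i ℕ.≟ suc j) i≢1+j) (solve 2 (λ w x → 1′ :* w := 1′ :* w :+ 0′ :* x) refl (w i) (w (suc j)))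
      ... | tri≈ _ ≡.refl _ = step {i} {j} (𝟙-true (suc j ℕ.≤? suc j) ℕ.≤-refl) (𝟙-false (suc j ℕ.≤? j) ℕ.1+n≰n)
              (𝟙-true (suc j ℕ.≟ suc j) ≡.refl) (solve 1 (λ w → 1′ :* w := 0′ :* w :+ 1′ :* w) refl (w (suc j)))
      ... | tri> _ i≢1+j 1+j<i = step {i} {j} (𝟙-false (i ℕ.≤? suc j) (ℕ.<⇒≱ 1+j<i)) (𝟙-false (i ℕ.≤? j) (ℕ.<⇒≱ (ℕ.<⇒≤ 1+j<i)))
              (𝟙-false (i ℕ.≟ suc j) i≢1+j) (solve 2 (λ w x → 0′ :* w := 0′ :* w :+ 0′ :* x) refl (w i) (w (suc j)))

      truncated-0 : ∀ i → truncated 0 i ≈ δ 0 i * w 0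
      truncated-0 zero    = refl
      truncated-0 (suc i) = trans (zeroˡ _) (sym (zeroˡ _))

      -- Apply `φ` to `radial-truncated`. As `φ` turns `radial` into multiplication by θ, the two
      -- boundary terms must account for θ + r times the partial sum. Since `φ (δ j)` is the sum of
      -- u over the sphere of radius j about x, this determines each sphere sum from what lies
      -- inside.
      christoffel-darboux : ∀ j → φ (δ (suc j)) * (fromℕ (cᵢ (suc j)) * w j) ≈
        (θ + r) * φ (truncated j) + φ (δ j) * (fromℕ (bᵢ j) * w (suc j))
      christoffel-darboux j = begin
        φ (δ (suc j)) * Y
          ≈⟨ solve 5 (λ P a X bY r → bY := (P :* :- r :+ (a :* :- X :+ bY)) :+ r :* P :+ a :* X)
               refl (φ (truncated j)) (φ (δ j)) X (φ (δ (suc j)) * Y) r ⟩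
        (φ (truncated j) * - r + (φ (δ j) * - X + φ (δ (suc j)) * Y)) + r * φ (truncated j) + φ (δ j) * X
          ≈⟨ +-congʳ (+-congʳ expansion) ⟨
        θ * φ (truncated j) + r * φ (truncated j) + φ (δ j) * X
          ≈⟨ +-congʳ (distribʳ _ _ _) ⟨
        (θ + r) * φ (truncated j) + φ (δ j) * X ∎
        where
        X = fromℕ (bᵢ j) * w (suc j)
        Y = fromℕ (cᵢ (suc j)) * w j
        expansion : θ * φ (truncated j) ≈ φ (truncated j) * - r + (φ (δ j) * - X + φ (δ (suc j)) * Y)
        expansion = begin
          θ * φ (truncated j)
            ≈⟨ φ-radial (truncated j) ⟨
          φ (radial (truncated j))
            ≈⟨ φ-cong radial-truncated ⟩
          φ (λ i → truncated j i * - r + (δ j i * - X + δ (suc j) i * Y))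
            ≈⟨ φ-+ (λ i → truncated j i * - r) (λ i → δ j i * - X + δ (suc j) i * Y) ⟩
          φ (λ i → truncated j i * - r) + φ (λ i → δ j i * - X + δ (suc j) i * Y)
            ≈⟨ +-cong (φ-* (truncated j) (- r)) (trans (φ-+ (λ i → δ j i * - X) (λ i → δ (suc j) i * Y))
                 (+-cong (φ-* (δ j) (- X)) (φ-* (δ (suc j)) Y))) ⟩
          φ (truncated j) * - r + (φ (δ j) * - X + φ (δ (suc j)) * Y) ∎

      φδ₀ : φ (δ 0) ≈ v x * v x
      φδ₀ = trans
        (∑-only x λ y x≢y → trans (*-congˡ (reflexive (𝟙-false (d x y ℕ.≟ 0) (x≢y ∘ d≡0⇒≡)))) (zeroʳ _))
        (trans (*-congˡ (reflexive (𝟙-true (d x x ℕ.≟ 0) (d-refl x)))) (*-identityʳ _))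

      -- Multiplying `christoffel-darboux` by - ρ j turns w_j on the left into w_{j+1}. On the right
      -- it turns the factor θ + r into the positive ρ j (- r - θ), and the sign of w_{j+1} cancels,
      -- so both terms are positive by induction.
      φ-pos : ∀ j → j ≤ D → 0# <ᴿ φ (truncated j) × 0# <ᴿ φ (δ j) * w j
      φ-pos zero    _   = <-respʳ (sym φ₀) φδ₀-pos , φδ₀-pos
        where
        φ₀ : φ (truncated 0) ≈ φ (δ 0) * w 0
        φ₀ = trans (φ-cong λ {i} _ → truncated-0 i) (φ-* (δ 0) 1#)
        φδ₀-pos : 0# <ᴿ φ (δ 0) * w 0
        φδ₀-pos = <-respʳ (sym (trans (*-identityʳ _) φδ₀)) (square-pos (proj₂ (proj₁ (proj₂ eigenvalue))))
      φ-pos (suc j) j<D with φ-pos j (ℕ.<⇒≤ j<D)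
      ... | P-pos , φw-pos = <-respʳ (sym φ-suc) (+-pos P-pos next) , next
        where
        φ-suc : φ (truncated (suc j)) ≈ φ (truncated j) + φ (δ (suc j)) * w (suc j)
        φ-suc = trans (φ-cong {truncated (suc j)} λ {i} _ → truncated-suc j i)
          (trans (φ-+ (truncated j) (λ i → δ (suc j) i * w (suc j))) (+-congˡ (φ-* (δ (suc j)) (w (suc j)))))
        eq : fromℕ (cᵢ (suc j)) * (φ (δ (suc j)) * w (suc j)) ≈
             ρ j * ((- r - θ) * φ (truncated j) + ρ j * (fromℕ (bᵢ j) * (φ (δ j) * w j)))
        eq = begin
          fromℕ (cᵢ (suc j)) * (φ (δ (suc j)) * (- ρ j * w j))
            ≈⟨ solve 4 (λ c φ ρ w → c :* (φ :* (:- ρ :* w)) := :- ρ :* (φ :* (c :* w)))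
                 refl (fromℕ (cᵢ (suc j))) (φ (δ (suc j))) (ρ j) (w j) ⟩
          - ρ j * (φ (δ (suc j)) * (fromℕ (cᵢ (suc j)) * w j))
            ≈⟨ *-congˡ (christoffel-darboux j) ⟩
          - ρ j * ((θ + r) * φ (truncated j) + φ (δ j) * (fromℕ (bᵢ j) * (- ρ j * w j)))
            ≈⟨ solve 7 (λ θ r P φ b ρ w → :- ρ :* ((θ :+ r) :* P :+ φ :* (b :* (:- ρ :* w)))
                   := ρ :* ((:- r :- θ) :* P :+ ρ :* (b :* (φ :* w))))
                 refl θ r (φ (truncated j)) (φ (δ j)) (fromℕ (bᵢ j)) (ρ j) (w j) ⟩
          ρ j * ((- r - θ) * φ (truncated j) + ρ j * (fromℕ (bᵢ j) * (φ (δ j) * w j))) ∎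
        next : 0# <ᴿ φ (δ (suc j)) * w (suc j)
        next = *-pos-cancelˡ (fromℕ-≥1 (c-pos diameter j<D)) (<-respʳ (sym eq)
          (*-pos (ρ-pos j<D) (+-pos (*-pos (0<y-x θ<-r) P-pos)
            (*-pos (ρ-pos j<D) (*-pos (fromℕ-≥1 (b-pos diameter j<D)) φw-pos)))))

    -- At j = D nothing is cut off, so there is no boundary term: θ and - r act alike on `φ w`.
    -- Their difference times `φ w` is then 0, although both factors are positive.
    eigenvalue-≥ : ⊥
    eigenvalue-≥ = <-irrefl (sym zero-product) (*-pos (0<y-x θ<-r) (proj₁ (φ-pos D ℕ.≤-refl)))
      where
      φw : φ (truncated D) ≈ φ w
      φw = φ-cong {truncated D} {w} λ {i} i≤D → trans (*-congʳ (reflexive (𝟙-true (i ℕ.≤? D) i≤D))) (*-identityˡ _)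
      θφw : θ * φ w ≈ φ w * - r
      θφw = trans (sym (φ-radial w)) (trans (φ-cong {radial w} λ i≤D → trans (radial-w i≤D) (*-comm _ _)) (φ-* w (- r)))
      zero-product : (- r - θ) * φ (truncated D) ≈ 0#
      zero-product = begin
        (- r - θ) * φ (truncated D)  ≈⟨ *-congˡ φw ⟩
        (- r - θ) * φ w              ≈⟨ solve 3 (λ r θ p → (:- r :- θ) :* p := p :* :- r :- θ :* p) refl r θ (φ w) ⟩
        φ w * - r - θ * φ w          ≈⟨ +-congˡ (-‿cong θφw) ⟩
        φ w * - r - φ w * - r        ≈⟨ -‿inverseʳ _ ⟩
        0#                           ∎

  smallest-eigenvalue : ∀ {θ} → IsSmallestEigenvalue ℝ Γ θ → θ ≈ - r
  smallest-eigenvalue (eigenvalue , θ≤) = ≤-antisym (eigenvalue-≥ eigenvalue) (θ≤ (- r) eigenvalue-minus-r)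

  delsarte-size : ∀ {S} → IsDelsarteClique ℝ Γ (bᵢ 0) S → fromℕ ∣ S ∣ ≈ 1# + β
  delsarte-size {S} (_ , θ , smallest , (ι , ι*-θ≈1 , _) , size) = trans size (+-congˡ (begin
    fromℕ (bᵢ 0) * ι  ≈⟨ *-congʳ k≈ ⟩
    r * β * ι         ≈⟨ solve 3 (λ r β ι → r :* β :* ι := ι :* (:- :- r) :* β) refl r β ι ⟩
    ι * - - r * β     ≈⟨ *-congʳ (*-congˡ (-‿cong (smallest-eigenvalue smallest))) ⟨
    ι * - θ * β       ≈⟨ *-congʳ ι*-θ≈1 ⟩
    1# * β            ≈⟨ *-identityˡ β ⟩
    β                 ∎))

-- Enumeration of the lines and their incidence matrix.

lookup-injective : ∀ {a} {A : Set a} {xs : List A} → Unique xs → ∀ i j →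
                   List.lookup xs i ≡ List.lookup xs j → i ≡ j
lookup-injective (_    ∷ _)      zero    zero    _  = ≡.refl
lookup-injective (x∉xs ∷ _)      zero    (suc j) eq = contradiction eq (All.lookup x∉xs (∈-lookup j))
lookup-injective (x∉xs ∷ _)      (suc i) zero    eq = contradiction (≡.sym eq) (All.lookup x∉xs (∈-lookup i))
lookup-injective (_    ∷ unique) (suc i) (suc j) eq = ≡.cong suc (lookup-injective unique i j eq)

module LineSystem (Γ : ConnectedGraph) {p} (𝒞 : Pred (Subset (ConnectedGraph.order Γ)) p) where
  open Distance Γ

  module Enumeration
    (clique : ∀ S → 𝒞 S → IsClique S)
    (line : ∀ {x y} → Adj x y → Subset order)
    (line-∈𝒞 : ∀ {x y} (adj : Adj x y) → 𝒞 (line adj) × x ∈ line adj × y ∈ line adj)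
    (line-unique : ∀ {x y} (adj : Adj x y) {S} → 𝒞 S × x ∈ S × y ∈ S → line adj ≡ S) where

    private
      line-of : ∀ {x y} → Dec (Adj x y) → List (Subset order)
      line-of (yes adj) = List.[ line adj ]
      line-of (no _)    = []

      lines-through : Vertex → List (Subset order)
      lines-through x = concatMap (λ y → line-of (adj? x y)) (List.allFin order)

      all-lines : List (Subset order)
      all-lines = concatMap lines-through (List.allFin order)

      _≟_ = ≡-dec {n = order} Bool._≟_

      -- Membership in `𝒞` is not assumed decidable, so the lines are collected from the edges they
      -- contain. Deduplication gives each of them a single index, and sums over indices count
      -- lines.
      lines : List (Subset order)
      lines = List.deduplicate _≟_ all-lines

      line-of-∈𝒞 : ∀ {x y S} (adj? : Dec (Adj x y)) → S ∈ᴸ line-of adj? → 𝒞 S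
      line-of-∈𝒞 (yes adj) (here ≡.refl) = proj₁ (line-∈𝒞 adj)

      lines-∈𝒞 : ∀ {S} → S ∈ᴸ lines → 𝒞 S
      lines-∈𝒞 S∈ with find (∈-concatMap⁻ lines-through {xs = List.allFin order} (∈-deduplicate⁻ _≟_ all-lines S∈))
      ... | x , _ , S∈′ with find (∈-concatMap⁻ (λ y → line-of (adj? x y)) {xs = List.allFin order} S∈′)
      ...   | y , _ , S∈″ = line-of-∈𝒞 (adj? x y) S∈″

      ∈-line-of : ∀ {x y S} (adj? : Dec (Adj x y)) → Adj x y → 𝒞 S × x ∈ S × y ∈ S → S ∈ᴸ line-of adj?
      ∈-line-of (yes adj) _   S∈ = here (≡.sym (line-unique adj S∈))
      ∈-line-of (no ¬adj) adj _  = contradiction adj ¬adj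

      ∈-lines : ∀ {x y S} → Adj x y → 𝒞 S × x ∈ S × y ∈ S → S ∈ᴸ lines
      ∈-lines {x} {y} adj S∈ = ∈-deduplicate⁺ _≟_ (∈-concatMap⁺ lines-through (lose (∈-allFin x)
        (∈-concatMap⁺ (λ y → line-of (adj? x y)) (lose (∈-allFin y) (∈-line-of (adj? x y) adj S∈)))))

    opaque
      m : ℕ
      m = List.length lines

      M : Fin m → Subset order
      M = List.lookup lines

      M-∈𝒞 : ∀ i → 𝒞 (M i)
      M-∈𝒞 i = lines-∈𝒞 (∈-lookup i)

      M-surjective : ∀ {x y S} → Adj x y → 𝒞 S → x ∈ S → y ∈ S → ∃ λ i → M i ≡ S
      M-surjective {S = S} adj S∈𝒞 x∈S y∈S = Any.index S∈ , ≡.sym (lookup-index S∈)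
        where
        S∈ : S ∈ᴸ lines
        S∈ = ∈-lines adj (S∈𝒞 , x∈S , y∈S)

      M-injective : ∀ {i j} → M i ≡ M j → i ≡ j
      M-injective {i} {j} = lookup-injective (deduplicate-! _≟_ all-lines) i j

    M-adj : ∀ {x y i} → x ≢ y → x ∈ M i → y ∈ M i → Adj x y
    M-adj {i = i} x≢y x∈ y∈ = clique (M i) (M-∈𝒞 i) _ _ x∈ y∈ x≢y

    M-unique : ∀ {x y i j} → x ≢ y → x ∈ M i → y ∈ M i → x ∈ M j → y ∈ M j → i ≡ j
    M-unique {i = i} {j} x≢y x∈ y∈ x∈′ y∈′ = M-injective
      (≡.trans (≡.sym (line-unique adj (M-∈𝒞 i , x∈ , y∈))) (line-unique adj (M-∈𝒞 j , x∈′ , y∈′)))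
      where adj = M-adj x≢y x∈ y∈

    joining : ∀ {x y} → Adj x y → ∃ λ i → x ∈ M i × y ∈ M i
    joining {x} {y} adj with line-∈𝒞 adj
    ... | ∈𝒞 , x∈ , y∈ with M-surjective adj ∈𝒞 x∈ y∈
    ...   | i , eq = i , ≡.subst (x ∈_) (≡.sym eq) x∈ , ≡.subst (y ∈_) (≡.sym eq) y∈

    module Incidence {c ℓ} (R : Semiring c ℓ) where
      open Semiring R hiding (zero)
      open Summation R

      -- The semiring is left open because the matrix is used with real entries for the eigenvector
      -- and with natural entries for the counting.
      I : Vertex → Fin m → Carrier
      I y i = 𝟙 (y ∈? M i)

      I*I-true : ∀ {y z i} → y ∈ M i → z ∈ M i → I y i * I z i ≈ 1#
      I*I-true {y} {z} {i} y∈ z∈ =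
        trans (*-cong (reflexive (𝟙-true (y ∈? M i) y∈)) (reflexive (𝟙-true (z ∈? M i) z∈))) (*-identityˡ 1#)

      I*I-false : ∀ {y z i} → ¬ (y ∈ M i × z ∈ M i) → I y i * I z i ≈ 0#
      I*I-false {y} {z} {i} ∉ =
        trans (sym (𝟙-× (y ∈? M i) (z ∈? M i))) (reflexive (𝟙-false ((y ∈? M i) ×-dec (z ∈? M i)) ∉))

      ∑I*I : ∀ {y z} → y ≢ z → ∑ (λ i → I y i * I z i) ≈ 𝟙 (adj? y z)
      ∑I*I {y} {z} y≢z = go (adj? y z)
        where
        go : (adj? : Dec (Adj y z)) → ∑ (λ i → I y i * I z i) ≈ 𝟙 adj?
        go (no ¬adj) = ∑-zero λ i → I*I-false {y} {z} {i} λ (y∈ , z∈) → ¬adj (M-adj y≢z y∈ z∈)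
        go (yes adj) with joining adj
        ... | i , y∈ , z∈ = trans
          (∑-only i λ j i≢j → I*I-false {y} {z} {j} λ (y∈′ , z∈′) → i≢j (M-unique y≢z y∈ z∈ y∈′ z∈′))
          (I*I-true {y} {z} {i} y∈ z∈)

      -- Off the diagonal, adjacent points share exactly one line and other points none. On the
      -- diagonal stands the number of lines through y, which is not yet known to be constant here.
      ∑I*I′ : ∀ y z → ∑ (λ i → I y i * I z i) ≈ 𝟙 (adj? y z) + 𝟙 (y Fin.≟ z) * ∑ (I y)
      ∑I*I′ y z = go (y Fin.≟ z)
        where
        I*I : ∀ {i} (y∈? : Dec (y ∈ M i)) → 𝟙 y∈? * 𝟙 y∈? ≈ 𝟙 y∈?
        I*I (yes _) = *-identityˡ 1#
        I*I (no _)  = zeroˡ 0#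
        go : (y≟z : Dec (y ≡ z)) → ∑ (λ i → I y i * I z i) ≈ 𝟙 (adj? y z) + 𝟙 y≟z * ∑ (I y)
        go (yes ≡.refl) = trans (∑-cong λ i → I*I (y ∈? M i)) (sym (trans
          (+-cong (reflexive (𝟙-false (adj? y y) (irrefl ≡.refl))) (*-identityˡ _)) (+-identityˡ _)))
        go (no y≢z) = trans (∑I*I y≢z) (sym (trans (+-congˡ (zeroˡ _)) (+-identityʳ _)))

-- The eigenvector on lines, and the number of points at a given distance.

module Geometry {c ℓ₁ ℓ₂ p} (ℝ : RealNumbers c ℓ₁ ℓ₂) (Γ : ConnectedGraph) {bᵢ cᵢ : ℕ → ℕ}
                (regular : ConnectedGraph.IsDistanceRegular Γ bᵢ cᵢ)
                (n : ℕ) .{{_ : ℤ.NonZero (+ suc (suc n) ℤ.- 1ℤ)}} {D : ℕ} {α β : RealNumbers.Carrier ℝ}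
                (classical : HasClassicalParameters ℝ Γ bᵢ cᵢ D (+ suc (suc n)) α β) (0<D : 0 < D)
                (𝒞 : Pred (Subset (ConnectedGraph.order Γ)) p) (geometric : IsGeometric ℝ Γ (bᵢ 0) 𝒞) where
  open RealProperties ℝ
  open Distance Γ
  open Regular regular
  open Radial ℝ Γ regular
  open Spectrum ℝ Γ regular n classical 0<D
  open LineSystem Γ 𝒞
  open Enumeration (λ S S∈𝒞 → proj₁ (proj₁ geometric S S∈𝒞))
    (λ adj → proj₁ (proj₂ geometric _ _ adj))
    (λ adj → proj₁ (proj₂ (proj₂ geometric _ _ adj)))
    (λ adj → proj₂ (proj₂ (proj₂ geometric _ _ adj))) public
  open Incidence semiring
  open SetoidReasoning setoid
  open Solver using (solve; _:=_; _:+_; _:*_; _:-_; :-_; con)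

  private
    0′ 1′ : ∀ {n} → Solver.Polynomial n
    0′ = con (+ 0)
    1′ = con (+ 1)

  size : ∀ {S} → 𝒞 S → fromℕ ∣ S ∣ ≈ 1# + β
  size {S} S∈𝒞 = delsarte-size (proj₁ geometric S S∈𝒞)

  ∑I≈1+β : ∀ i → ∑ (λ y → I y i) ≈ 1# + β
  ∑I≈1+β i = trans (sym (fromℕ-∑-𝟙 (_∈? M i))) (trans (reflexive (≡.cong fromℕ (≡.sym (Counting.∣∣≡∑ (M i))))) (size (M-∈𝒞 i)))

  β-pos : 0# <ᴿ β
  β-pos = <-respʳ (solve 2 (λ α β → β :- α :* 0′ := β) refl α β) (β-αq-pos 0<D)

  1+β#0 : 1# + β # 0#
  1+β#0 = >⇒# (+-pos 0<1 β-pos)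

  ∑-A : ∀ y → ∑ (A y) ≈ r * β
  ∑-A y = trans (sym (fromℕ-∑-𝟙 (adj? y))) (trans (reflexive (≡.cong fromℕ (valency y))) k≈)

  ∑-δ : ∀ y (f : Vertex → Carrier) → ∑ (λ z → 𝟙 (y Fin.≟ z) * f z) ≈ f y
  ∑-δ y f = trans (∑-only y λ z y≢z → trans (*-congʳ (reflexive (𝟙-false (y Fin.≟ z) y≢z))) (zeroˡ _))
    (trans (*-congʳ (reflexive (𝟙-true (y Fin.≟ y) ≡.refl))) (*-identityˡ _))

  -- Count the pairs of a line through y and a point on it. By lines there are t (1 + β); by points
  -- there are k = r β from the neighbours of y and t from y itself. Now cancel β.
  lines-per-point : ∀ y → ∑ (I y) ≈ r
  lines-per-point y = *-cancelˡ (>⇒# β-pos) (begin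
    β * t                  ≈⟨ solve 2 (λ β t → β :* t := t :* (1′ :+ β) :- t) refl β t ⟩
    t * (1# + β) - t       ≈⟨ +-congʳ double-count ⟩
    r * β + t - t          ≈⟨ solve 3 (λ r β t → r :* β :+ t :- t := β :* r) refl r β t ⟩
    β * r                  ∎)
    where
    t = ∑ (I y)
    double-count : t * (1# + β) ≈ r * β + t
    double-count = begin
      ∑ (I y) * (1# + β)                                ≈⟨ ∑-*ʳ (1# + β) (I y) ⟨
      ∑ (λ i → I y i * (1# + β))                        ≈⟨ ∑-cong (λ i → *-congˡ (∑I≈1+β i)) ⟨
      ∑ (λ i → I y i * ∑ (λ z → I z i))                 ≈⟨ ∑-cong (λ i → ∑-*ˡ (I y i) (λ z → I z i)) ⟨
      ∑ (λ i → ∑ (λ z → I y i * I z i))                 ≈⟨ ∑-swap (λ i z → I y i * I z i) ⟩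
      ∑ (λ z → ∑ (λ i → I y i * I z i))                 ≈⟨ ∑-cong (λ z → ∑I*I′ y z) ⟩
      ∑ (λ z → A y z + 𝟙 (y Fin.≟ z) * t)               ≈⟨ ∑-+ (A y) (λ z → 𝟙 (y Fin.≟ z) * t) ⟩
      ∑ (A y) + ∑ (λ z → 𝟙 (y Fin.≟ z) * t)             ≈⟨ +-cong (∑-A y) (∑-δ y (λ _ → t)) ⟩
      r * β + t                                         ∎

  N*Nᵀ : ∀ y z → ∑ (λ i → I y i * I z i) ≈ A y z + 𝟙 (y Fin.≟ z) * r
  N*Nᵀ y z = trans (∑I*I′ y z) (+-congˡ (*-congˡ (lines-per-point y)))

  -- The vector of line sums is Nᵀ f, and its squared length is fᵀ N Nᵀ f = fᵀ (A + r) f = 0.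
  ∑-on-line : ∀ (f : Vertex → Carrier) → (∀ y → ∑ (λ z → A y z * f z) ≈ - r * f y) →
              ∀ i → ∑ (λ y → I y i * f y) ≈ 0#
  ∑-on-line f Af≈-rf = ∑-squares≈0 (λ i → ∑ (λ y → I y i * f y)) (begin
    ∑ (λ i → ∑ (λ y → I y i * f y) * ∑ (λ y → I y i * f y))
      ≈⟨ ∑-cong (λ i → ∑-*ʳ (∑ (λ y → I y i * f y)) (λ y → I y i * f y)) ⟨
    ∑ (λ i → ∑ (λ y → I y i * f y * ∑ (λ z → I z i * f z)))
      ≈⟨ ∑-swap (λ i y → I y i * f y * ∑ (λ z → I z i * f z)) ⟩
    ∑ (λ y → ∑ (λ i → I y i * f y * ∑ (λ z → I z i * f z)))
      ≈⟨ ∑-zero (λ y → trans (∑-cong (rearrange y)) (trans (∑-*ˡ (f y) (λ i → ∑ (λ z → I y i * I z i * f z))) (trans (*-congˡ (row y)) (zeroʳ _)))) ⟩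
    0# ∎)
    where
    rearrange : ∀ y i → I y i * f y * ∑ (λ z → I z i * f z) ≈ f y * ∑ (λ z → I y i * I z i * f z)
    rearrange y i = begin
      I y i * f y * ∑ (λ z → I z i * f z)     ≈⟨ solve 3 (λ a b c → a :* b :* c := b :* (a :* c)) refl (I y i) (f y) (∑ (λ z → I z i * f z)) ⟩
      f y * (I y i * ∑ (λ z → I z i * f z))   ≈⟨ *-congˡ (∑-*ˡ (I y i) (λ z → I z i * f z)) ⟨
      f y * ∑ (λ z → I y i * (I z i * f z))   ≈⟨ *-congˡ (∑-cong λ z → sym (*-assoc _ _ _)) ⟩
      f y * ∑ (λ z → I y i * I z i * f z)     ∎
    row : ∀ y → ∑ (λ i → ∑ (λ z → I y i * I z i * f z)) ≈ 0#
    row y = begin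
      ∑ (λ i → ∑ (λ z → I y i * I z i * f z))               ≈⟨ ∑-swap (λ i z → I y i * I z i * f z) ⟩
      ∑ (λ z → ∑ (λ i → I y i * I z i * f z))               ≈⟨ ∑-cong (λ z → trans (∑-*ʳ (f z) (λ i → I y i * I z i)) (*-congʳ (N*Nᵀ y z))) ⟩
      ∑ (λ z → (A y z + 𝟙 (y Fin.≟ z) * r) * f z)           ≈⟨ ∑-cong (λ z → trans (distribʳ _ _ _) (+-congˡ (*-assoc _ _ _))) ⟩
      ∑ (λ z → A y z * f z + 𝟙 (y Fin.≟ z) * (r * f z))     ≈⟨ ∑-+ (λ z → A y z * f z) (λ z → 𝟙 (y Fin.≟ z) * (r * f z)) ⟩
      ∑ (λ z → A y z * f z) + ∑ (λ z → 𝟙 (y Fin.≟ z) * (r * f z)) ≈⟨ +-cong (Af≈-rf y) (∑-δ y (λ z → r * f z)) ⟩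
      - r * f y + r * f y                                   ≈⟨ solve 2 (λ r f → :- r :* f :+ r :* f := 0′) refl r (f y) ⟩
      0#                                                    ∎

  at-distance? : ∀ i x j y → Dec (y ∈ M i × d x y ≡ j)
  at-distance? i x j y = (y ∈? M i) ×-dec (d x y ℕ.≟ j)

  -- If N points have distance j, the line sum of w is N w_j + (1 + β - N) w_{j+1} = 0, so N = (1 +
  -- β - N) ρ j. Clearing the denominator of ρ j gives a linear equation in which N has coefficient
  -- 1 + β. A line with all its points at distance j is covered too.
  distance-count : ∀ {j} → j < D → ∀ x i → (∀ y → y ∈ M i → d x y ≡ j ⊎ d x y ≡ suc j) →
                   fromℕ (Counting.∑ (λ y → Counting.𝟙 (at-distance? i x j y))) ≈ 1# + α * q j
  distance-count {j} j<D x i on-line = trans (fromℕ-∑-𝟙 (at-distance? i x j)) (*-cancelˡ 1+β#0 (begin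
    (1# + β) * N
      ≈⟨ solve 4 (λ N β α q → (1′ :+ β) :* N := N :* (β :- α :* q) :+ N :* (1′ :+ α :* q)) refl N β α (q j) ⟩
    N * (β - α * q j) + N * (1# + α * q j)
      ≈⟨ +-congʳ (*-congʳ N≈) ⟩
    (1# + β - N) * ρ j * (β - α * q j) + N * (1# + α * q j)
      ≈⟨ +-congʳ (trans (*-assoc _ _ _) (*-congˡ (ρ≈ j<D))) ⟩
    (1# + β - N) * (1# + α * q j) + N * (1# + α * q j)
      ≈⟨ solve 3 (λ N β a → (1′ :+ β :- N) :* a :+ N :* a := (1′ :+ β) :* a) refl N β (1# + α * q j) ⟩
    (1# + β) * (1# + α * q j) ∎))
    where
    B : Vertex → Carrier
    B y = 𝟙 (at-distance? i x j y)
    N = ∑ B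
    pointwise : ∀ y → I y i * w (d x y) ≈ B y * (w j - w (suc j)) + I y i * w (suc j)
    pointwise y = go (y ∈? M i)
      where
      expand : ∀ {a b v} → I y i ≡ a → B y ≡ b → w (d x y) ≡ v →
               a * v ≈ b * (w j - w (suc j)) + a * w (suc j) →
               I y i * w (d x y) ≈ B y * (w j - w (suc j)) + I y i * w (suc j)
      expand ≡.refl ≡.refl ≡.refl eq = eq
      go : Dec (y ∈ M i) → I y i * w (d x y) ≈ B y * (w j - w (suc j)) + I y i * w (suc j)
      go (no y∉) = expand (𝟙-false (y ∈? M i) y∉) (𝟙-false (at-distance? i x j y) (y∉ ∘ proj₁)) ≡.refl
        (solve 3 (λ v a b → 0′ :* v := 0′ :* (a :- b) :+ 0′ :* b) refl (w (d x y)) (w j) (w (suc j)))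
      go (yes y∈) with on-line y y∈
      ... | inj₁ eq = expand (𝟙-true (y ∈? M i) y∈) (𝟙-true (at-distance? i x j y) (y∈ , eq)) (≡.cong w eq)
        (solve 2 (λ a b → 1′ :* a := 1′ :* (a :- b) :+ 1′ :* b) refl (w j) (w (suc j)))
      ... | inj₂ eq = expand (𝟙-true (y ∈? M i) y∈)
        (𝟙-false (at-distance? i x j y) λ (_ , eq′) → ℕ.1+n≢n (≡.trans (≡.sym eq) eq′)) (≡.cong w eq)
        (solve 2 (λ a b → 1′ :* b := 0′ :* (a :- b) :+ 1′ :* b) refl (w j) (w (suc j)))
    -- The ring identity splits the line sum of w, expressed through N, off from `w j * N`. That sum
    -- is zero, and `w j` can be cancelled.
    N≈ : N ≈ (1# + β - N) * ρ j
    N≈ = *-cancelˡ (w#0 (ℕ.<⇒≤ j<D)) (begin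
      w j * N
        ≈⟨ solve 4 (λ w N ρ b → w :* N := N :* (w :- :- ρ :* w) :+ (1′ :+ b) :* (:- ρ :* w) :+ w :* ((1′ :+ b :- N) :* ρ)) refl (w j) N (ρ j) β ⟩
      N * (w j - w (suc j)) + (1# + β) * w (suc j) + w j * ((1# + β - N) * ρ j)
        ≈⟨ +-congʳ (+-cong (∑-*ʳ _ B) (trans (∑-*ʳ _ (λ y → I y i)) (*-congʳ (∑I≈1+β i)))) ⟨
      ∑ (λ y → B y * (w j - w (suc j))) + ∑ (λ y → I y i * w (suc j)) + w j * ((1# + β - N) * ρ j)
        ≈⟨ +-congʳ (trans (∑-cong pointwise) (∑-+ (λ y → B y * (w j - w (suc j))) (λ y → I y i * w (suc j)))) ⟨
      ∑ (λ y → I y i * w (d x y)) + w j * ((1# + β - N) * ρ j)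
        ≈⟨ +-congʳ (∑-on-line (λ y → w (d x y)) (adjacency-w x) i) ⟩
      0# + w j * ((1# + β - N) * ρ j)
        ≈⟨ +-identityˡ _ ⟩
      w j * ((1# + β - N) * ρ j) ∎)

-- Counting the lines through a vertex and comparing brackets.

module Brackets {c ℓ₁ ℓ₂ p} (ℝ : RealNumbers c ℓ₁ ℓ₂) (Γ : ConnectedGraph) {bᵢ cᵢ : ℕ → ℕ}
                (regular : ConnectedGraph.IsDistanceRegular Γ bᵢ cᵢ)
                (n : ℕ) .{{_ : ℤ.NonZero (+ suc (suc n) ℤ.- 1ℤ)}} {D : ℕ} {α β : RealNumbers.Carrier ℝ}
                (classical : HasClassicalParameters ℝ Γ bᵢ cᵢ D (+ suc (suc n)) α β) (2<D : 2 < D)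
                (𝒞 : Pred (Subset (ConnectedGraph.order Γ)) p) (geometric : IsGeometric ℝ Γ (bᵢ 0) 𝒞) where

  0<D : 0 < D
  0<D = ℕ.<-trans (s≤s z≤n) 2<D

  1<D : 1 < D
  1<D = ℕ.<-trans (s≤s (s≤s z≤n)) 2<D

  open Distance Γ
  open Regular regular
  open Geometry ℝ Γ regular n classical 0<D 𝒞 geometric
  open Counting
  open Incidence ℕ.+-*-semiring
  private
    module R = RealProperties ℝ
    module S = Spectrum ℝ Γ regular n classical 0<D

  b r : ℕ
  b = suc (suc n)
  r = gauss b D

  ⁺-count : {P : Pred Vertex 0ℓ} (P? : Decidable P) → (∃ λ y → P y) → ∃ λ k → ∑ (λ y → 𝟙 (P? y)) ≡ suc k
  ⁺-count P? (y , py) with ∑ (λ y → 𝟙 (P? y)) | ∑-𝟙-pos P? y py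
  ... | suc k | _ = k , ≡.refl

  d-line≤1 : ∀ {i y z} → y ∈ M i → z ∈ M i → d y z ≤ 1
  d-line≤1 {i} {y} {z} y∈ z∈ with y Fin.≟ z
  ... | yes ≡.refl = ℕ.≤-trans (ℕ.≤-reflexive (d-refl y)) z≤n
  ... | no y≢z     = ℕ.≤-reflexive (Adj⇒d≡1 (M-adj y≢z y∈ z∈))

  triangle : ∀ x y z → d x z ≤ d x y ℕ.+ d y z
  triangle x y z = d-min (walk-++ (d-walk x y) (d-walk y z))

  1≤d : ∀ {i x y} → x ∉ M i → y ∈ M i → 1 ≤ d x y
  1≤d {i} {x} {y} x∉ y∈ with d x y in eq
  ... | zero  = contradiction (≡.subst (_∈ M i) (≡.sym (d≡0⇒≡ eq)) y∈) x∉
  ... | suc _ = s≤s z≤n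

  Near : Vertex → Fin m → Set
  Near y i = ∃ λ u → u ∈ M i × Adj y u

  near? : ∀ y i → Dec (Near y i)
  near? y i = Fin.any? λ u → (u ∈? M i) ×-dec adj? y u

  near-d≤2 : ∀ {y i} → Near y i → ∀ u → u ∈ M i → d y u ≤ 2
  near-d≤2 {y} (z , z∈ , adj) u u∈ = ℕ.≤-trans (triangle y z u)
    (ℕ.+-mono-≤ (ℕ.≤-reflexive (Adj⇒d≡1 adj)) (d-line≤1 z∈ u∈))

  far-2≤d : ∀ {y i} → y ∉ M i → ¬ Near y i → ∀ u → u ∈ M i → 2 ≤ d y u
  far-2≤d {y} y∉ far u u∈ with d y u in eq | 1≤d y∉ u∈
  ... | suc zero    | _ = contradiction (u , u∈ , d≡1⇒Adj eq) far
  ... | suc (suc _) | _ = s≤s (s≤s z≤n)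

  d≡2⇒∉ : ∀ {x y i} → d x y ≡ 2 → x ∈ M i → y ∉ M i
  d≡2⇒∉ eq x∈ y∈ = contradiction (≡.subst (_≤ 1) eq (d-line≤1 x∈ y∈)) λ where (s≤s ())

  between : ∀ {j k} → j ≤ k → k ≤ suc j → k ≡ j ⊎ k ≡ suc j
  between j≤k k≤1+j with ℕ.m≤n⇒m<n∨m≡n k≤1+j
  ... | inj₁ (s≤s k≤j) = inj₁ (ℕ.≤-antisym k≤j j≤k)
  ... | inj₂ eq        = inj₂ eq

  module _ (x : Vertex) (L : Fin m) (x∉L : x ∉ M L) (nearL : Near x L) where

    at-distance-1-or-2 : ∀ {y i} → y ∉ M i → Near y i → ∀ u → u ∈ M i → d y u ≡ 1 ⊎ d y u ≡ 2
    at-distance-1-or-2 y∉ near u u∈ = between (1≤d y∉ u∈) (near-d≤2 near u u∈)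

    private
      α-witness : ∃ λ k → ∑ (λ y → 𝟙 (at-distance? L x 1 y)) ≡ suc k
      α-witness = ⁺-count (at-distance? L x 1) (proj₁ nearL , proj₁ (proj₂ nearL) , Adj⇒d≡1 (proj₂ (proj₂ nearL)))

      β-witness : ∃ λ k → ∑ (λ y → 𝟙 (y ∈? M L)) ≡ suc k
      β-witness = ⁺-count (_∈? M L) (proj₁ nearL , proj₁ (proj₂ nearL))

    opaque
      -- These turn out to be α and β, because the two counts on L are 1 + α and 1 + β. From then on
      -- all counting takes place in ℕ.
      a s : ℕ
      a = proj₁ α-witness
      s = proj₁ β-witness

      on-L-1 : ∑ (λ y → 𝟙 (at-distance? L x 1 y)) ≡ suc a
      on-L-1 = proj₂ α-witness

      ∑I-L : ∑ (λ y → I y L) ≡ suc s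
      ∑I-L = proj₂ β-witness

    module _ where
      open RealProperties ℝ hiding (∑; 𝟙; ∑-cong; ∑-zero; ∑-+; ∑-*ˡ; ∑-*ʳ; ∑-swap; ∑-only; 𝟙-true; 𝟙-false; 𝟙-⇔; 𝟙-×; 𝟙-*-cong)
      open Solver using (solve; _:=_; _:+_; _:*_; _:-_; :-_; con)
      open SetoidReasoning setoid

      q1≈1 : S.q 1 ≈ 1#
      q1≈1 = trans (reflexive (≡.cong (λ k → fromℕ (suc k)) (ℕ.*-zeroʳ b))) (+-identityʳ 1#)

      q2≈ : S.q 2 ≈ fromℕ (suc b)
      q2≈ = reflexive (≡.cong (λ k → fromℕ (suc k)) (≡.trans (≡.cong (λ k → b ℕ.* suc k) (ℕ.*-zeroʳ b)) (ℕ.*-identityʳ b)))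

      α≈a : α ≈ fromℕ a
      α≈a = trans (solve 1 (λ α → α := (con (+ 1) :+ α :* con (+ 1)) :- con (+ 1)) refl α) (begin
        1# + α * 1# - 1#     ≈⟨ +-congʳ (+-congˡ (*-congˡ q1≈1)) ⟨
        1# + α * S.q 1 - 1#  ≈⟨ +-congʳ (distance-count 1<D x L (at-distance-1-or-2 x∉L nearL)) ⟨
        fromℕ (∑ (λ y → 𝟙 (at-distance? L x 1 y))) - 1# ≈⟨ +-congʳ (reflexive (≡.cong fromℕ on-L-1)) ⟩
        1# + fromℕ a - 1#    ≈⟨ solve 1 (λ α → (con (+ 1) :+ α) :- con (+ 1) := α) refl (fromℕ a) ⟩
        fromℕ a              ∎)

      β≈s : β ≈ fromℕ s
      β≈s = begin
        β                                 ≈⟨ solve 1 (λ β → β := (con (+ 1) :+ β) :- con (+ 1)) refl β ⟩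
        1# + β - 1#                       ≈⟨ +-congʳ (∑I≈1+β L) ⟨
        R.∑ (λ y → R.𝟙 (y ∈? M L)) - 1#   ≈⟨ +-congʳ (fromℕ-∑-𝟙 (_∈? M L)) ⟨
        fromℕ (∑ (λ y → I y L)) - 1#      ≈⟨ +-congʳ (reflexive (≡.cong fromℕ ∑I-L)) ⟩
        1# + fromℕ s - 1#                 ≈⟨ solve 1 (λ β → (con (+ 1) :+ β) :- con (+ 1) := β) refl (fromℕ s) ⟩
        fromℕ s                           ∎

      ∑I≡1+s : ∀ i → ∑ (λ y → I y i) ≡ suc s
      ∑I≡1+s i = fromℕ-injective (trans (fromℕ-∑-𝟙 (_∈? M i)) (trans (∑I≈1+β i) (+-congˡ β≈s)))

      degree : ∀ y → ∑ (I y) ≡ r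
      degree y = fromℕ-injective (trans (fromℕ-∑-𝟙 (λ i → y ∈? M i)) (lines-per-point y))

      count-1 : ∀ {y i} → y ∉ M i → Near y i → ∑ (λ u → 𝟙 (at-distance? i y 1 u)) ≡ suc a
      count-1 {y} {i} y∉ near = fromℕ-injective (trans (distance-count 1<D y i (at-distance-1-or-2 y∉ near))
        (+-congˡ (trans (*-congˡ q1≈1) (trans (*-identityʳ α) α≈a))))

      count-2 : ∀ {y i} → (∀ u → u ∈ M i → d y u ≡ 2 ⊎ d y u ≡ 3) →
                ∑ (λ u → 𝟙 (at-distance? i y 2 u)) ≡ suc (a ℕ.* suc b)
      count-2 {y} {i} on-line = fromℕ-injective (trans (distance-count 2<D y i on-line)
        (+-congˡ (trans (*-cong α≈a q2≈) (sym (fromℕ-* a (suc b))))))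

      c₂≡ : cᵢ 2 ≡ suc b ℕ.* suc a
      c₂≡ = fromℕ-injective (trans (S.c≈ (ℕ.<⇒≤ 2<D)) (trans
        (*-cong q2≈ (+-congˡ (trans (*-congˡ q1≈1) (trans (*-identityʳ α) α≈a)))) (sym (fromℕ-* (suc b) (suc a)))))

      -- This is the positivity of β - α [2], the factor of `bᵢ 2`, with [2] = b + 1.
      ab<s : a ℕ.* suc b < s
      ab<s = fromℕ-cancel-< (<-respˡ (trans (*-cong α≈a q2≈) (sym (fromℕ-* a (suc b)))) (<-respʳ β≈s (0<y-x⇒x<y (S.β-αq-pos 2<D))))

      -- Here k stands for r - 1 - α; an equation introduces it so that no truncated subtraction
      -- occurs. The summand a is removed later, when s is split as a + g.
      β-bound : ∀ k → r ≡ suc a ℕ.+ k → (S.r - α - 1#) * α * fromℕ b + α <ᴿ β → k ℕ.* (a ℕ.* b) ℕ.+ a < s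
      β-bound k r≡ bound = fromℕ-cancel-< (<-respˡ (begin
        (S.r - α - 1#) * α * fromℕ b + α
          ≈⟨ +-cong (*-congʳ (*-cong (+-congʳ (+-cong (trans (reflexive (≡.cong fromℕ r≡)) (fromℕ-+ (suc a) k)) (-‿cong α≈a))) α≈a)) α≈a ⟩
        (1# + fromℕ a + fromℕ k - fromℕ a - 1#) * fromℕ a * fromℕ b + fromℕ a
          ≈⟨ solve 3 (λ k a b → (con (+ 1) :+ a :+ k :- a :- con (+ 1)) :* a :* b :+ a := k :* (a :* b) :+ a) refl (fromℕ k) (fromℕ a) (fromℕ b) ⟩
        fromℕ k * (fromℕ a * fromℕ b) + fromℕ a
          ≈⟨ trans (fromℕ-+ (k ℕ.* (a ℕ.* b)) a) (+-congʳ (trans (fromℕ-* k (a ℕ.* b)) (*-congˡ (fromℕ-* a b)))) ⟨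
        fromℕ (k ℕ.* (a ℕ.* b) ℕ.+ a) ∎) (<-respʳ β≈s bound))

    joins? : ∀ y i u → Dec (u ∈ M i × Adj y u)
    joins? y i u = (u ∈? M i) ×-dec adj? y u

    neighbours-on-line : ∀ {y i} → y ∉ M i → Near y i → ∑ (λ u → 𝟙 (joins? y i u)) ≡ suc a
    neighbours-on-line {y} {i} y∉ near = ≡.trans
      (∑-cong λ u → 𝟙-⇔ (joins? y i u) (at-distance? i y 1 u)
        (λ (u∈ , adj) → u∈ , Adj⇒d≡1 adj) (λ (u∈ , eq) → u∈ , d≡1⇒Adj eq))
      (count-1 y∉ near)

    no-neighbours-on-line : ∀ {y i} → ¬ Near y i → ∑ (λ u → 𝟙 (joins? y i u)) ≡ 0
    no-neighbours-on-line {y} {i} far = ∑-zero λ u → 𝟙-false (joins? y i u) λ (u∈ , adj) → far (u , u∈ , adj)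

    -- A point off a line has either no neighbour on it or exactly 1 + a, so passing from near lines
    -- to edges costs a constant factor. The condition P guarantees that y is off the line.
    near-count : ∀ {p y i} {P : Set p} (p? : Dec P) → (P → y ∉ M i) →
                 𝟙 (p? ×-dec near? y i) ℕ.* suc a ≡ 𝟙 p? ℕ.* ∑ (λ u → 𝟙 (joins? y i u))
    near-count {y = y} {i} {P} p? ∉ = ≡.trans (≡.cong (ℕ._* suc a) (𝟙-× p? (near? y i))) (≡.trans (ℕ.*-assoc (𝟙 p?) _ _)
      (𝟙-*-cong p? λ p → go p (near? y i)))
      where
      go : P → (near : Dec (Near y i)) → 𝟙 near ℕ.* suc a ≡ ∑ (λ u → 𝟙 (joins? y i u))
      go p (yes near) = ≡.trans (ℕ.*-identityˡ _) (≡.sym (neighbours-on-line (∉ p) near))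
      go p (no far)   = ≡.sym (no-neighbours-on-line far)

    through-near? : ∀ y i → Dec (x ∈ M i × Near y i)
    through-near? y i = (x ∈? M i) ×-dec near? y i

    -- Each of the c₂ = (b + 1) (1 + α) common neighbours of x and y is on exactly one line through
    -- x, and each such line near y carries 1 + α of them.
    lines-near : ∀ {y} → d x y ≡ 2 → ∑ (λ i → 𝟙 (through-near? y i)) ≡ suc b
    lines-near {y} dxy = ℕ.*-cancelʳ-≡ _ _ (suc a) (begin
      ∑ (λ i → 𝟙 (through-near? y i)) ℕ.* suc a                         ≡⟨ ∑-*ʳ (suc a) (λ i → 𝟙 (through-near? y i)) ⟨
      ∑ (λ i → 𝟙 (through-near? y i) ℕ.* suc a)                         ≡⟨ ∑-cong (λ i → near-count (x ∈? M i) (d≡2⇒∉ dxy)) ⟩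
      ∑ (λ i → I x i ℕ.* ∑ (λ z → 𝟙 (joins? y i z)))                    ≡⟨ ∑-cong (λ i → ∑-*ˡ (I x i) (λ z → 𝟙 (joins? y i z))) ⟨
      ∑ (λ i → ∑ (λ z → I x i ℕ.* 𝟙 (joins? y i z)))                    ≡⟨ ∑-swap (λ i z → I x i ℕ.* 𝟙 (joins? y i z)) ⟩
      ∑ (λ z → ∑ (λ i → I x i ℕ.* 𝟙 (joins? y i z)))                    ≡⟨ ∑-cong count-point ⟩
      ∑ (λ z → 𝟙 (closer? y x z))                                       ≡⟨ ∑-closer y x ⟩
      cᵢ (d y x)                                                        ≡⟨ ≡.cong cᵢ (≡.trans (d-sym y x) dxy) ⟩
      cᵢ 2                                                              ≡⟨ c₂≡ ⟩
      suc b ℕ.* suc a                                                   ∎)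
      where
      open ≡-Reasoning
      count-point : ∀ z → ∑ (λ i → I x i ℕ.* 𝟙 (joins? y i z)) ≡ 𝟙 (closer? y x z)
      count-point z = begin
        ∑ (λ i → I x i ℕ.* 𝟙 (joins? y i z))            ≡⟨ ∑-cong (λ i → ≡.trans (≡.cong (I x i ℕ.*_) (𝟙-× (z ∈? M i) (adj? y z))) (≡.sym (ℕ.*-assoc (I x i) _ _))) ⟩
        ∑ (λ i → I x i ℕ.* I z i ℕ.* 𝟙 (adj? y z))      ≡⟨ ∑-*ʳ (𝟙 (adj? y z)) (λ i → I x i ℕ.* I z i) ⟩
        ∑ (λ i → I x i ℕ.* I z i) ℕ.* 𝟙 (adj? y z)      ≡⟨ ℕ.*-comm (∑ (λ i → I x i ℕ.* I z i)) _ ⟩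
        𝟙 (adj? y z) ℕ.* ∑ (λ i → I x i ℕ.* I z i)      ≡⟨ 𝟙-*-cong (adj? y z) (λ adj → ∑I*I λ x≡z → not-adj (≡.subst (Adj y) (≡.sym x≡z) adj)) ⟩
        𝟙 (adj? y z) ℕ.* 𝟙 (adj? x z)                   ≡⟨ 𝟙-× (adj? y z) (adj? x z) ⟨
        𝟙 (adj? y z ×-dec adj? x z)                     ≡⟨ 𝟙-⇔ (adj? y z ×-dec adj? x z) (closer? y x z)
                                                             (λ (yz , xz) → xz , ≡.trans (≡.cong suc (Adj⇒d≡1 yz)) dyx)
                                                             (λ (xz , eq) → d≡1⇒Adj (ℕ.suc-injective (≡.trans eq (≡.sym dyx))) , xz) ⟩
        𝟙 (closer? y x z)                               ∎
        where
        dyx : 2 ≡ d y x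
        dyx = ≡.sym (≡.trans (d-sym y x) dxy)
        not-adj : ¬ Adj y x
        not-adj adj = contradiction (≡.trans dyx (Adj⇒d≡1 adj)) λ ()

    split-L : ∀ {y} → y ∈ M L → d x y ≡ 1 ⊎ d x y ≡ 2
    split-L {y} = at-distance-1-or-2 x∉L nearL y

    1≢2 : ∀ {y} → y ∈ M L × d x y ≡ 1 → y ∈ M L × d x y ≡ 2 → ⊥
    1≢2 (_ , eq) (_ , eq′) = contradiction (≡.trans (≡.sym eq) eq′) λ ()

    G? : ∀ y → Dec (y ∈ M L × d x y ≡ 2)
    G? = at-distance? L x 2

    g : ℕ
    g = ∑ (λ y → 𝟙 (G? y))

    s≡a+g : s ≡ a ℕ.+ g
    s≡a+g = ℕ.suc-injective (begin
      suc s                                                             ≡⟨ ∑I-L ⟨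
      ∑ (λ y → I y L)                                                   ≡⟨ ∑-cong (λ y → 𝟙-partition (at-distance? L x 1 y) (G? y) (y ∈? M L) 1≢2 proj₁ proj₁ (λ y∈ → Sum.map (y∈ ,_) (y∈ ,_) (split-L y∈))) ⟩
      ∑ (λ y → 𝟙 (at-distance? L x 1 y) ℕ.+ 𝟙 (G? y))                   ≡⟨ ∑-+ (λ y → 𝟙 (at-distance? L x 1 y)) (λ y → 𝟙 (G? y)) ⟩
      ∑ (λ y → 𝟙 (at-distance? L x 1 y)) ℕ.+ g                          ≡⟨ ≡.cong (ℕ._+ g) on-L-1 ⟩
      suc a ℕ.+ g                                                       ∎)
      where
      open ≡-Reasoning

    Misses : Vertex → Fin m → Set
    Misses y i = (y ∈ M L × d x y ≡ 2) × ¬ Near y i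

    partial? : ∀ i → Dec (∃ λ y → Misses y i)
    partial? i = Fin.any? λ y → G? y ×-dec ¬? (near? y i)

    full? : ∀ i → Dec (x ∈ M i × ¬ ∃ λ y → Misses y i)
    full? i = (x ∈? M i) ×-dec ¬? (partial? i)

    through-partial? : ∀ i → Dec (x ∈ M i × ∃ λ y → Misses y i)
    through-partial? i = (x ∈? M i) ×-dec partial? i

    near-G? : ∀ i y → Dec ((y ∈ M L × d x y ≡ 2) × Near y i)
    near-G? i y = G? y ×-dec near? y i

    full-near : ∀ {y i} → ¬ (∃ λ y → Misses y i) → y ∈ M L → d x y ≡ 2 → Near y i
    full-near {y} {i} full y∈ dxy with near? y i
    ... | yes near = near
    ... | no far   = contradiction (y , (y∈ , dxy) , far) full

    -- L is a clique, so the common point z is a neighbour of every y in G. The case y = z is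
    -- impossible, because y is at distance 2 from x and z shares a line with x.
    meeting-full : ∀ {i z} → x ∈ M i → z ∈ M i → z ∈ M L → ¬ (∃ λ y → Misses y i)
    meeting-full {i} {z} x∈ z∈ z∈L (y , (y∈L , dxy) , far) with y Fin.≟ z
    ... | yes ≡.refl = d≡2⇒∉ dxy x∈ z∈
    ... | no y≢z     = far (z , z∈ , M-adj y≢z y∈L z∈L)

    full-count : ℕ
    full-count = ∑ (λ i → 𝟙 (full? i))

    -- The lines joining x to the 1 + a points of L next to it meet L and are therefore full. They
    -- are distinct: a line with two of these points would be L, which does not contain x.
    full-count≥ : suc a ≤ full-count
    full-count≥ = begin
      suc a                                                       ≡⟨ on-L-1 ⟨
      ∑ (λ z → 𝟙 (at-distance? L x 1 z))                          ≡⟨ ∑-cong joined ⟩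
      ∑ (λ z → ∑ (λ i → 𝟙 (joined? i z)))                         ≡⟨ ∑-swap (λ z i → 𝟙 (joined? i z)) ⟩
      ∑ (λ i → ∑ (λ z → 𝟙 (joined? i z)))                         ≤⟨ ∑-mono (λ i → ∑-𝟙-unique-≤ (joined? i) (full? i)
                                                                       (λ (at , x∈ , z∈) → x∈ , meeting-full x∈ z∈ (proj₁ at))
                                                                       unique) ⟩
      full-count                                                  ∎
      where
      open ℕ.≤-Reasoning
      joined? : ∀ i z → Dec ((z ∈ M L × d x z ≡ 1) × x ∈ M i × z ∈ M i)
      joined? i z = at-distance? L x 1 z ×-dec (x ∈? M i ×-dec z ∈? M i)
      joined : ∀ z → 𝟙 (at-distance? L x 1 z) ≡ ∑ (λ i → 𝟙 (joined? i z))
      joined z = ≡.sym (≡-Reasoning.begin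
        ∑ (λ i → 𝟙 (joined? i z))                                ≡-Reasoning.≡⟨ ∑-cong (λ i → ≡.trans (𝟙-× at (x ∈? M i ×-dec z ∈? M i)) (≡.cong (𝟙 at ℕ.*_) (𝟙-× (x ∈? M i) (z ∈? M i)))) ⟩
        ∑ (λ i → 𝟙 at ℕ.* (I x i ℕ.* I z i))                     ≡-Reasoning.≡⟨ ∑-*ˡ (𝟙 at) (λ i → I x i ℕ.* I z i) ⟩
        𝟙 at ℕ.* ∑ (λ i → I x i ℕ.* I z i)                       ≡-Reasoning.≡⟨ 𝟙-*-cong at (λ (z∈ , eq) → ≡.trans
                                                                      (∑I*I λ x≡z → x∉L (≡.subst (_∈ M L) (≡.sym x≡z) z∈)) (𝟙-true (adj? x z) (d≡1⇒Adj eq))) ⟩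
        𝟙 at ℕ.* 1                                               ≡-Reasoning.≡⟨ ℕ.*-identityʳ _ ⟩
        𝟙 at                                                     ≡-Reasoning.∎)
        where
        at : Dec (z ∈ M L × d x z ≡ 1)
        at = at-distance? L x 1 z
      unique : ∀ {i z z′} → (z ∈ M L × d x z ≡ 1) × x ∈ M i × z ∈ M i →
               (z′ ∈ M L × d x z′ ≡ 1) × x ∈ M i × z′ ∈ M i → z ≡ z′
      unique {i} {z} {z′} ((z∈L , _) , x∈ , z∈) ((z′∈L , _) , _ , z′∈) with z Fin.≟ z′
      ... | yes z≡z′ = z≡z′
      ... | no z≢z′  = contradiction (≡.subst (λ j → x ∈ M j) (M-unique z≢z′ z∈ z′∈ z∈L z′∈L) x∈) x∉L

    -- Double counting of the edges between L and M i: a point of M i with a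
    -- neighbour on L is at distance 2 from the point y₀ of L that misses M i.
    partial-bound : ∀ {i y₀} → x ∈ M i → Misses y₀ i → ∑ (λ y → 𝟙 (near-G? i y)) ≤ a ℕ.* b
    partial-bound {i} {y₀} x∈ misses@((y₀∈L , dxy₀) , far) = ℕ.+-cancelˡ-≤ (suc a) _ _ (begin
      suc a ℕ.+ ∑ (λ y → 𝟙 (near-G? i y))    ≤⟨ ℕ.*-cancelʳ-≤ _ _ (suc a) edges ⟩
      suc (a ℕ.* suc b)                      ≡⟨ ≡.cong suc (ℕ.*-suc a b) ⟩
      suc a ℕ.+ a ℕ.* b                      ∎)
      where
      open ℕ.≤-Reasoning
      disjoint : ∀ {z} → z ∈ M L → z ∉ M i
      disjoint z∈L z∈ = meeting-full x∈ z∈ z∈L (y₀ , misses)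
      at1-near : ∀ {y} → y ∈ M L × d x y ≡ 1 → Near y i
      at1-near (_ , eq) = x , x∈ , Adj-sym (d≡1⇒Adj eq)
      2or3 : ∀ u → u ∈ M i → d y₀ u ≡ 2 ⊎ d y₀ u ≡ 3
      2or3 u u∈ = between (far-2≤d (disjoint y₀∈L) far u u∈) (ℕ.≤-trans (triangle y₀ x u)
        (ℕ.+-mono-≤ (ℕ.≤-reflexive (≡.trans (d-sym y₀ x) dxy₀)) (d-line≤1 x∈ u∈)))
      near-L? : ∀ u → Dec (u ∈ M i × Near u L)
      near-L? u = (u ∈? M i) ×-dec near? u L
      swap-joins : ∀ y u → I y L ℕ.* 𝟙 (joins? y i u) ≡ I u i ℕ.* 𝟙 (joins? u L y)
      swap-joins y u = ≡.trans (≡.sym (𝟙-× (y ∈? M L) (joins? y i u))) (≡.trans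
        (𝟙-⇔ (y ∈? M L ×-dec joins? y i u) (u ∈? M i ×-dec joins? u L y)
          (λ (y∈ , u∈ , adj) → u∈ , y∈ , Adj-sym adj) (λ (u∈ , y∈ , adj) → y∈ , u∈ , Adj-sym adj))
        (𝟙-× (u ∈? M i) (joins? u L y)))
      edges : (suc a ℕ.+ ∑ (λ y → 𝟙 (near-G? i y))) ℕ.* suc a ≤ suc (a ℕ.* suc b) ℕ.* suc a
      edges = begin
        (suc a ℕ.+ ∑ (λ y → 𝟙 (near-G? i y))) ℕ.* suc a
          ≡⟨ ≡.cong (λ k → (k ℕ.+ ∑ (λ y → 𝟙 (near-G? i y))) ℕ.* suc a) on-L-1 ⟨
        (∑ (λ y → 𝟙 (at-distance? L x 1 y)) ℕ.+ ∑ (λ y → 𝟙 (near-G? i y))) ℕ.* suc a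
          ≡⟨ ≡.cong (ℕ._* suc a) (∑-+ (λ y → 𝟙 (at-distance? L x 1 y)) (λ y → 𝟙 (near-G? i y))) ⟨
        ∑ (λ y → 𝟙 (at-distance? L x 1 y) ℕ.+ 𝟙 (near-G? i y)) ℕ.* suc a
          ≤⟨ ℕ.*-monoˡ-≤ (suc a) (∑-mono λ y → 𝟙-disjoint-≤ (at-distance? L x 1 y) (near-G? i y) (y ∈? M L ×-dec near? y i)
               (λ at1 (at2 , _) → 1≢2 at1 at2) (λ at1 → proj₁ at1 , at1-near at1) (λ (at2 , near) → proj₁ at2 , near)) ⟩
        ∑ (λ y → 𝟙 (y ∈? M L ×-dec near? y i)) ℕ.* suc a
          ≡⟨ ∑-*ʳ (suc a) (λ y → 𝟙 (y ∈? M L ×-dec near? y i)) ⟨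
        ∑ (λ y → 𝟙 (y ∈? M L ×-dec near? y i) ℕ.* suc a)
          ≡⟨ ∑-cong (λ y → near-count (y ∈? M L) disjoint) ⟩
        ∑ (λ y → I y L ℕ.* ∑ (λ u → 𝟙 (joins? y i u)))
          ≡⟨ ∑-cong (λ y → ∑-*ˡ (I y L) (λ u → 𝟙 (joins? y i u))) ⟨
        ∑ (λ y → ∑ (λ u → I y L ℕ.* 𝟙 (joins? y i u)))
          ≡⟨ ∑-swap (λ y u → I y L ℕ.* 𝟙 (joins? y i u)) ⟩
        ∑ (λ u → ∑ (λ y → I y L ℕ.* 𝟙 (joins? y i u)))
          ≡⟨ ∑-cong (λ u → ≡.trans (∑-cong λ y → swap-joins y u) (∑-*ˡ (I u i) (λ y → 𝟙 (joins? u L y)))) ⟩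
        ∑ (λ u → I u i ℕ.* ∑ (λ y → 𝟙 (joins? u L y)))
          ≡⟨ ∑-cong (λ u → near-count (u ∈? M i) (λ u∈ u∈L → disjoint u∈L u∈)) ⟨
        ∑ (λ u → 𝟙 (near-L? u) ℕ.* suc a)
          ≡⟨ ∑-*ʳ (suc a) (λ u → 𝟙 (near-L? u)) ⟩
        ∑ (λ u → 𝟙 (near-L? u)) ℕ.* suc a
          ≤⟨ ℕ.*-monoˡ-≤ (suc a) (∑-mono λ u → 𝟙-≤ (near-L? u) (at-distance? i y₀ 2 u)
               (λ (u∈ , near) → u∈ , ℕ.≤-antisym (≡.subst (_≤ 2) (d-sym u y₀) (near-d≤2 near y₀ y₀∈L)) (far-2≤d (disjoint y₀∈L) far u u∈))) ⟩
        ∑ (λ u → 𝟙 (at-distance? i y₀ 2 u)) ℕ.* suc a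
          ≡⟨ ≡.cong (ℕ._* suc a) (count-2 2or3) ⟩
        suc (a ℕ.* suc b) ℕ.* suc a ∎

    partial-count : ℕ
    partial-count = ∑ (λ i → 𝟙 (through-partial? i))

    full+partial : full-count ℕ.+ partial-count ≡ r
    full+partial = ≡.trans (≡.sym (∑-+ (λ i → 𝟙 (full? i)) (λ i → 𝟙 (through-partial? i)))) (≡.trans
      (∑-cong λ i → ≡.sym (𝟙-partition (full? i) (through-partial? i) (x ∈? M i)
        (λ (_ , full) (_ , partial) → full partial) proj₁ proj₁ λ x∈ → case x∈ (partial? i)))
      (degree x))
      where
      case : ∀ {i} → x ∈ M i → Dec (∃ λ y → Misses y i) →
             (x ∈ M i × ¬ ∃ λ y → Misses y i) ⊎ (x ∈ M i × ∃ λ y → Misses y i)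
      case x∈ (yes partial) = inj₂ (x∈ , partial)
      case x∈ (no full)     = inj₁ (x∈ , full)

    -- By points, every y in G is near b + 1 lines through x. By lines, a full one serves at most g
    -- points of G and any other at most a b.
    near-pairs : g ℕ.* suc b ≤ full-count ℕ.* g ℕ.+ partial-count ℕ.* (a ℕ.* b)
    near-pairs = begin
      g ℕ.* suc b
        ≡⟨ ∑-*ʳ (suc b) (λ y → 𝟙 (G? y)) ⟨
      ∑ (λ y → 𝟙 (G? y) ℕ.* suc b)
        ≡⟨ ∑-cong (λ y → 𝟙-*-cong (G? y) λ (_ , dxy) → lines-near dxy) ⟨
      ∑ (λ y → 𝟙 (G? y) ℕ.* ∑ (λ i → 𝟙 (through-near? y i)))
        ≡⟨ ∑-cong (λ y → ∑-*ˡ (𝟙 (G? y)) (λ i → 𝟙 (through-near? y i))) ⟨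
      ∑ (λ y → ∑ (λ i → 𝟙 (G? y) ℕ.* 𝟙 (through-near? y i)))
        ≡⟨ ∑-swap (λ y i → 𝟙 (G? y) ℕ.* 𝟙 (through-near? y i)) ⟩
      ∑ (λ i → ∑ (λ y → 𝟙 (G? y) ℕ.* 𝟙 (through-near? y i)))
        ≡⟨ ∑-cong (λ i → ≡.trans (∑-cong (λ y → exchange i y)) (∑-*ˡ (I x i) (λ y → 𝟙 (near-G? i y)))) ⟩
      ∑ (λ i → I x i ℕ.* ∑ (λ y → 𝟙 (near-G? i y)))
        ≤⟨ ∑-mono (λ i → bound i (x ∈? M i) (partial? i)) ⟩
      ∑ (λ i → 𝟙 (full? i) ℕ.* g ℕ.+ 𝟙 (through-partial? i) ℕ.* (a ℕ.* b))
        ≡⟨ ≡.trans (∑-+ (λ i → 𝟙 (full? i) ℕ.* g) (λ i → 𝟙 (through-partial? i) ℕ.* (a ℕ.* b)))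
             (≡.cong₂ ℕ._+_ (∑-*ʳ g (λ i → 𝟙 (full? i))) (∑-*ʳ (a ℕ.* b) (λ i → 𝟙 (through-partial? i)))) ⟩
      full-count ℕ.* g ℕ.+ partial-count ℕ.* (a ℕ.* b) ∎
      where
      open ℕ.≤-Reasoning
      exchange : ∀ i y → 𝟙 (G? y) ℕ.* 𝟙 (through-near? y i) ≡ I x i ℕ.* 𝟙 (near-G? i y)
      exchange i y = ≡.trans (≡.sym (𝟙-× (G? y) (through-near? y i))) (≡.trans
        (𝟙-⇔ (G? y ×-dec through-near? y i) (x ∈? M i ×-dec near-G? i y)
          (λ (at2 , x∈ , near) → x∈ , at2 , near) (λ (x∈ , at2 , near) → at2 , x∈ , near))
        (𝟙-× (x ∈? M i) (near-G? i y)))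
      bound : ∀ i (x∈? : Dec (x ∈ M i)) (partial? : Dec (∃ λ y → Misses y i)) →
              𝟙 x∈? ℕ.* ∑ (λ y → 𝟙 (near-G? i y)) ≤
              𝟙 (x∈? ×-dec ¬? partial?) ℕ.* g ℕ.+ 𝟙 (x∈? ×-dec partial?) ℕ.* (a ℕ.* b)
      bound i (no _)   _                      = z≤n
      bound i (yes x∈) (yes (y₀ , misses))    = ℕ.*-monoʳ-≤ 1 (partial-bound x∈ misses)
      bound i (yes x∈) (no _)                 = ℕ.≤-trans
        (ℕ.*-monoʳ-≤ 1 (∑-mono λ y → 𝟙-≤ (near-G? i y) (G? y) proj₁)) (ℕ.m≤m+n (1 ℕ.* g) 0)

    -- The b + 1 lines through x that are near y include all full lines and, in addition, the line
    -- i.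
    partial⇒full-count≤b : ∀ {i y y₀} → x ∈ M i → y ∈ M L → d x y ≡ 2 → Near y i → Misses y₀ i → full-count ≤ b
    partial⇒full-count≤b {i} {y} {y₀} x∈ y∈ dxy near misses = ℕ.≤-pred (begin
      suc full-count                                      ≡⟨ ℕ.+-comm 1 full-count ⟩
      full-count ℕ.+ 1                                    ≡⟨ ≡.cong (full-count ℕ.+_) single ⟨
      full-count ℕ.+ ∑ (λ j → 𝟙 (i Fin.≟ j))              ≡⟨ ∑-+ (λ j → 𝟙 (full? j)) (λ j → 𝟙 (i Fin.≟ j)) ⟨
      ∑ (λ j → 𝟙 (full? j) ℕ.+ 𝟙 (i Fin.≟ j))             ≤⟨ ∑-mono (λ j → 𝟙-disjoint-≤ (full? j) (i Fin.≟ j) (through-near? y j)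
                                                               (λ { (_ , full) ≡.refl → full (y₀ , misses) })
                                                               (λ (x∈′ , full) → x∈′ , full-near full y∈ dxy)
                                                               (λ { ≡.refl → x∈ , near })) ⟩
      ∑ (λ j → 𝟙 (through-near? y j))                     ≡⟨ lines-near dxy ⟩
      suc b                                               ∎)
      where
      open ℕ.≤-Reasoning
      single : ∑ (λ j → 𝟙 (i Fin.≟ j)) ≡ 1
      single = ≡.trans (∑-only i λ j i≢j → 𝟙-false (i Fin.≟ j) i≢j) (𝟙-true (i Fin.≟ i) ≡.refl)

    near⇒all-near : (S.r R.- α R.- R.1#) R.* α R.* R.fromℕ b R.+ α R.<ᴿ β →
                    ∀ {i y y₀} → x ∈ M i → y ∈ M L → d x y ≡ 2 → Near y i → ¬ Misses y₀ i
    near⇒all-near β-large x∈ y∈ dxy near misses with ℕ.m≤n⇒∃[o]m+o≡n full-count≥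
    ... | t , full≡ = ℕ.<⇒≱ ab-small g-small
      where
      -- With t the number of full lines beyond the guaranteed 1 + a, this k is r - 1 - a. Enlarging
      -- `partial-count` to k brings the upper bound on g into the form of `β-bound`.
      k = t ℕ.+ partial-count
      r≡ : r ≡ suc a ℕ.+ k
      r≡ = ≡.trans (≡.sym full+partial) (≡.trans (≡.cong (ℕ._+ partial-count) (≡.sym full≡)) (ℕ.+-assoc (suc a) t partial-count))
      ab-small : k ℕ.* (a ℕ.* b) < g
      ab-small = ℕ.+-cancelʳ-< a _ _ (≡.subst (k ℕ.* (a ℕ.* b) ℕ.+ a <_) (≡.trans s≡a+g (ℕ.+-comm a g)) (β-bound k r≡ β-large))
      g-small : g ≤ k ℕ.* (a ℕ.* b)
      g-small = ℕ.+-cancelˡ-≤ (b ℕ.* g) _ _ (begin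
        b ℕ.* g ℕ.+ g                                       ≡⟨ ≡.trans (ℕ.+-comm (b ℕ.* g) g) (ℕ.*-comm (suc b) g) ⟩
        g ℕ.* suc b                                         ≤⟨ near-pairs ⟩
        full-count ℕ.* g ℕ.+ partial-count ℕ.* (a ℕ.* b)    ≤⟨ ℕ.+-mono-≤ (ℕ.*-monoˡ-≤ g (partial⇒full-count≤b x∈ y∈ dxy near misses))
                                                                 (ℕ.*-monoˡ-≤ (a ℕ.* b) (ℕ.m≤n+m partial-count t)) ⟩
        b ℕ.* g ℕ.+ k ℕ.* (a ℕ.* b)                         ∎)
        where open ℕ.≤-Reasoning

    -- Without a neighbour of y on the line, all its 1 + s points would be at distance exactly 2
    -- from y, whereas `distance-count` allows only 1 + a (b + 1).
    bracket⇒near : ∀ {i y} → d x y ≡ 2 → x ∈ M i → (∀ u → u ∈ M i → d y u ≤ 2) → Near y i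
    bracket⇒near {i} {y} dxy x∈ d≤2 with near? y i
    ... | yes near = near
    ... | no far   = contradiction (ℕ.≤-reflexive (ℕ.suc-injective all-at-2)) (ℕ.<⇒≱ ab<s)
      where
      at-2 : ∀ u → u ∈ M i → d y u ≡ 2
      at-2 u u∈ = ℕ.≤-antisym (d≤2 u u∈) (far-2≤d (d≡2⇒∉ dxy x∈) far u u∈)
      all-at-2 : suc s ≡ suc (a ℕ.* suc b)
      all-at-2 = ≡.trans (≡.sym (∑I≡1+s i)) (≡.trans
        (∑-cong λ u → 𝟙-⇔ (u ∈? M i) (at-distance? i y 2 u) (λ u∈ → u∈ , at-2 u u∈) proj₁)
        (count-2 λ u u∈ → inj₁ (at-2 u u∈)))

    -- The enumeration contains only lines with an edge, so a second point is required. A line with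
    -- x as its only point would give s = 0, contrary to `ab<s`.
    index : ∀ {S} → 𝒞 S → x ∈ S → ∃ λ i → M i ≡ S
    index {S} S∈𝒞 x∈S with Fin.any? (λ z → z ∈? S ×-dec ¬? (x Fin.≟ z))
    ... | yes (z , z∈S , x≢z) = M-surjective (proj₁ (proj₁ geometric S S∈𝒞) x z x∈S z∈S x≢z) S∈𝒞 x∈S z∈S
    ... | no none = contradiction (≡.subst (1 ≤_) s≡0 (ℕ.≤-trans (s≤s z≤n) ab<s)) λ ()
      where
      ∣S∣≡1 : ∣ S ∣ ≡ 1
      ∣S∣≡1 = ≡.trans (∣∣≡∑ S) (≡.trans
        (∑-only x λ z x≢z → 𝟙-false (z ∈? S) λ z∈S → none (z , z∈S , x≢z)) (𝟙-true (x ∈? S) x∈S))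
      s≡0 : s ≡ 0
      s≡0 = ℕ.suc-injective (≡.trans (≡.sym (R.fromℕ-injective (R.trans (size S∈𝒞) (R.+-congˡ β≈s)))) ∣S∣≡1)

    bracket-⊆ : (S.r R.- α R.- R.1#) R.* α R.* R.fromℕ b R.+ α R.<ᴿ β →
                ∀ {y₁ y₂} → y₁ ∈ M L → y₂ ∈ M L → d x y₁ ≡ 2 → d x y₂ ≡ 2 →
                ∀ {S} → Bracket 𝒞 x y₁ S → Bracket 𝒞 x y₂ S
    bracket-⊆ β-large {y₁} {y₂} y₁∈ y₂∈ dxy₁ dxy₂ (S∈𝒞 , x∈S , d≤2) with index S∈𝒞 x∈S
    ... | i , ≡.refl with near? y₂ i
    ...   | yes near = S∈𝒞 , x∈S , near-d≤2 near
    ...   | no far   = contradiction ((y₂∈ , dxy₂) , far)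
              (near⇒all-near β-large x∈S y₁∈ dxy₁ (bracket⇒near dxy₁ x∈S d≤2))

theorem18 :
    ∀ {c ℓ₁ ℓ₂ p} (ℝ : RealNumbers c ℓ₁ ℓ₂) (Γ : ConnectedGraph) →
    let open RealNumbers ℝ
        open ConnectedGraph Γ
    in
    (bᵢ cᵢ : ℕ → ℕ) → IsDistanceRegular bᵢ cᵢ →
    (D : ℕ) (b : ℤ) .{{_ : ℤ.NonZero (b ℤ.- 1ℤ)}} (α β : Carrier) →
    HasClassicalParameters ℝ Γ bᵢ cᵢ D b α β →
    + 2 ℤ.≤ b → 3 ≤ D →
    (𝒞 : Pred (Subset order) p) → IsGeometric ℝ Γ (bᵢ 0) 𝒞 →
    let r = fromℤ (qint b D) in
    (r - α - 1#) * α * fromℤ b + α <ᴿ β →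
    (x : Vertex) (ℓ : Subset order) → 𝒞 ℓ → DistanceToSet x ℓ 1 →
    (y₁ y₂ : Vertex) → y₁ ∈ ℓ → y₂ ∈ ℓ → d x y₁ ≡ 2 → d x y₂ ≡ 2 →
    Bracket 𝒞 x y₁ ≐ Bracket 𝒞 x y₂
theorem18 ℝ Γ bᵢ cᵢ regular D (+ suc (suc n)) α β classical (ℤ.+≤+ (s≤s (s≤s z≤n))) 2<D 𝒞 geometric β-large
  x ℓ ℓ∈𝒞 ((z , z∈ℓ , dxz) , 1≤d-ℓ) y₁ y₂ y₁∈ℓ y₂∈ℓ dxy₁ dxy₂ = brackets (M-surjective Adj-y₁z ℓ∈𝒞 y₁∈ℓ z∈ℓ)
  where
  open Distance Γ
  open RealNumbers ℝ
  open Brackets ℝ Γ regular n classical 2<D 𝒞 geometric using (0<D; bracket-⊆)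
  open Geometry ℝ Γ regular n classical 0<D 𝒞 geometric using (M; M-surjective)

  y₁≢z : y₁ ≢ z
  y₁≢z y₁≡z = contradiction (≡.trans (≡.sym dxy₁) (≡.trans (≡.cong (d x) y₁≡z) dxz)) λ ()

  -- An edge inside ℓ, from which the enumeration yields an index for ℓ.
  Adj-y₁z : Adj y₁ z
  Adj-y₁z = proj₁ (proj₁ geometric ℓ ℓ∈𝒞) y₁ z y₁∈ℓ z∈ℓ y₁≢z

  x∉ℓ : x ∉ ℓ
  x∉ℓ x∈ℓ = contradiction (≡.subst (1 ≤_) (d-refl x) (1≤d-ℓ x x∈ℓ)) λ ()

  β-large′ : (fromℕ (gauss (suc (suc n)) D) - α - 1#) * α * fromℕ (suc (suc n)) + α <ᴿ β
  β-large′ = ≡.subst (λ r → (fromℤ r - α - 1#) * α * fromℕ (suc (suc n)) + α <ᴿ β) (qint≡gauss n D) β-large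

  brackets : (∃ λ i → M i ≡ ℓ) → Bracket 𝒞 x y₁ ≐ Bracket 𝒞 x y₂
  brackets (L , ≡.refl) =
    bracket-⊆ x L x∉ℓ near β-large′ y₁∈ℓ y₂∈ℓ dxy₁ dxy₂ , bracket-⊆ x L x∉ℓ near β-large′ y₂∈ℓ y₁∈ℓ dxy₂ dxy₁
    where near = z , z∈ℓ , d≡1⇒Adj dxz
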